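{- Suppose an improving multi-armed bandits instance $I$ with $k$ arms and horizon $T$ has Concavity Envelope Exponent $\beta_I\in(0,1]$. The algorithm $\mathrm{Hybrid}_{\alpha,B}$ with $\alpha\in(\beta_I,1]$ satisfies the following. (1) If the instance further satisfies $\Delta_I>0$, and the Gap Clearance Condition $GCC(\theta)$ holds for $\theta\le T/2$, then the algorithm with $B\in(\theta,T/2]$ identifies and commits to the best arm $i^\star$ in Stage 1. (2) If Stage 1 does not certify a best arm by time $B$, then Stage 2 finds an approximate best arm $\hat i$ such that $\mathbb{E}[f_{\hat i}(T)]\ \ge\ \Omega\!\left(k^{ -\alpha/(1+\alpha)}\right) f^\star(T)$, where the expectation is over the randomness of the algorithm.
   Context: An instance of the improving multi-armed bandits problem consists of $k$ arms; arm $i$ has a reward function $f_i$ that is nondecreasing, satisfies $f_i(0)=0$, and has diminishing returns: $f_i(t+1)-f_i(t)\le f_i(t)-f_i(t-1)$ for all $t\ge 1$. Pulling arm $i$ for the $t$-th time yields $f_i(t)$. The best arm $i^\star$ is the arm with the highest final reward $f_i(T)$, $f^\star=f_{i^\star}$, and $\Delta_I=f^\star(T)-\max_{j\ne i^\star}f_j(T)$. For $\beta\in(0,1]$, arm $i$ satisfies $\mathrm{LE}(\beta)$ if $f_i(t)\ge f_i(T)(t/T)^\beta$ for all $t\le T$; the Concavity Envelope Exponent is $\beta_I=\inf\{\beta\in(0,1]:\text{every arm of } I \text{ satisfies }\mathrm{LE}(\beta)\}$. Let $\gamma_i(t-1)=f_i(t)-f_i(t-1)$, $\triangle_i(t)=(T-t)\gamma_i(t-1)$,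 and $h_i(\epsilon)=\min\{n\in\{2,\dots,T\}:\triangle_i(n)\le\epsilon\}$. For $B\le T$, $GCC(B)$ means: $\Delta_I>0$ and $\sum_{i=1}^k h_i(\Delta_I/3)\le B$. $\mathrm{PTRR}_\alpha$ with parameters $(m,\tau)$ on reward functions $\{g_i\}$ for $n$ steps: repeatedly choose an arm $i$ uniformly at random among arms not chosen so far, set $s_i=0$, and keep pulling it (each pull increases $s_i$ by one) as long as $g_i(s_i)\ge m(s_i/\tau)^\alpha$; when the test first fails, move to a new arm; stop after $n$ pulls (or if no arm remains). It returns the arm maximizing the last value $g_i(s_i)$ reached. $\mathrm{Hybrid}_{\alpha,B}$, for $B\in\{1,\dots,T\}$ (the algorithm knows $T$ and $f^\star(T)$). Stage 1: initialize total pulls $t=0$ and, for each arm, $t_i=0$, $L_i=0$, $U_i=+\infty$. While $t<B$: for each arm with $t_i\ge1$ set $L_i=f_i(t_i)$ and $U_i=L_i+(T-t_i)\,(f_i(t_i)-f_i(t_i-1))$; let $\hat i=\arg\max_i L_i$; if $L_{\hat i}>\max_{j\neq\hat i}U_j$, return (commit to) $\hat i$ and stop; otherwise pull an arm maximizing $U_i-L_i$ and increase its $t_i$ and $t$ by one. Stage 2 (reached if nothing was returned): let $\tau'=(T-B)-k$, $m'=\frac{\tau'}{T}f^\star(T)$, $g_i(s)=f_i(t_i+s)$ with $t_i$ the pull counts at the end of Stage 1; run $\mathrm{PTRR}_\alpha$ with parameters $(m',\tau')$ on $\{g_i\}$ for $T-B$ steps and return the arm $\hat i$ it returns.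
   Formalization: In (2) the bound is proved under the added condition T − B − k ≥ δT for a fixed δ > 0, with the Ω-constant depending only on δ; without it the claim fails (e.g. T = 2k+2, B = k+1) or τ' ≤ 0 makes the Stage 2 test meaningless. -}

module Defs where

open import Algebra.Bundles using (CommutativeRing; Semiring)
import Algebra.Definitions.RawSemiring as RawSemiringDefinitions
open import Algebra.Structures using (IsCommutativeRing)
open import Data.Bool.Base using (if_then_else_)
open import Data.Fin.Base using (Fin)
import Data.Fin.Properties as Fin
open import Data.List.Base using (allFin; filter; map)
import Data.List.Extrema as Extrema
open import Data.Nat.Base as ℕ using (ℕ; zero; suc; pred)
import Data.Nat.ListAction as ℕList
open import Data.Product.Base using (_×_; _,_; ∃; ∃₂; proj₁)
open import Data.Sum.Base using (_⊎_; inj₁; inj₂; [_,_]′)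
open import Data.Vec.Base as Vec using (Vec; lookup; removeAt)
open import Data.Vec.Functional using (Vector; updateAt; toList)
open import Function.Base using (_∘_; const)
open import Relation.Binary.Bundles using (TotalOrder)
import Relation.Binary.Construct.Add.Extrema.NonStrict as AddExtrema
open import Relation.Binary.Structures using (IsDecTotalOrder)
open import Relation.Nullary.Construct.Add.Extrema using (_±; ⊥±; [_]; ⊤±)
open import Relation.Nullary.Decidable using (Dec; yes; no; does; ¬?)
open import Relation.Nullary.Negation using (¬_)

-- The real numbers, axiomatised as a Dedekind-complete ordered field with
-- decidable order (the classical reading).  These axioms determine the structure
-- up to isomorphism.  As usual in total settings, 0# ⁻¹ and the supremum of an
-- empty or unbounded predicate are unspecified.
record Reals : Set₁ where
  infix  8 -_ _⁻¹
  infixl 7 _*_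
  infixl 6 _+_
  infix  4 _≈_ _≤_
  field
    ℝ                 : Set
    _≈_ _≤_           : ℝ → ℝ → Set
    _+_ _*_           : ℝ → ℝ → ℝ
    -_ _⁻¹            : ℝ → ℝ
    0# 1#             : ℝ
    isCommutativeRing : IsCommutativeRing _≈_ _+_ _*_ -_ 0# 1#
    isDecTotalOrder   : IsDecTotalOrder _≈_ _≤_
    0≉1               : ¬ (0# ≈ 1#)
    ⁻¹-inverse        : ∀ x → ¬ (x ≈ 0#) → x * x ⁻¹ ≈ 1#
    +-monoʳ-≤         : ∀ x {y z} → y ≤ z → x + y ≤ x + z
    *-nonNeg          : ∀ {x y} → 0# ≤ x → 0# ≤ y → 0# ≤ x * y
    sup               : (ℝ → Set) → ℝ
    sup-upper         : ∀ P → (∃ λ u → ∀ x → P x → x ≤ u) → ∀ x → P x → x ≤ sup P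
    sup-least         : ∀ P → ∃ P → ∀ u → (∀ x → P x → x ≤ u) → sup P ≤ u

  commutativeRing : CommutativeRing _ _
  commutativeRing = record { isCommutativeRing = isCommutativeRing }

  open IsDecTotalOrder isDecTotalOrder public using (isTotalOrder; _≤?_; _≟_)

  open RawSemiringDefinitions (Semiring.rawSemiring (CommutativeRing.semiring commutativeRing)) public
    using (_^_; sum) renaming (_×_ to _·_)

module RealOperations (R : Reals) where
  open Reals R public

  infix  4 _<_
  infixl 7 _/_
  infixl 6 _-_
  infixr 8 _^ʳ_

  _<_ : ℝ → ℝ → Set
  x < y = ¬ (y ≤ x)

  _-_ : ℝ → ℝ → ℝ
  x - y = x + (- y)

  _/_ : ℝ → ℝ → ℝ
  x / y = x * y ⁻¹

  fromℕ : ℕ → ℝ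
  fromℕ n = n · 1#

  inf : (ℝ → Set) → ℝ
  inf P = - sup (λ x → P (- x))

  -- For 1 ≤ x and 0 ≤ y: the supremum of x^(p/q) over the rationals 0 ≤ p/q ≤ y,
  -- where x^(p/q) is the supremum of the z ≥ 0 with z^q ≤ x^p.
  power≥1 : ℝ → ℝ → ℝ
  power≥1 x y = sup λ z → 0# ≤ z × ∃₂ λ p q →
    fromℕ p ≤ fromℕ (suc q) * y × z ^ suc q ≤ x ^ p

  powerPositive : ∀ x y → Dec (1# ≤ x) → Dec (0# ≤ y) → ℝ
  powerPositive x y (yes _) (yes _) = power≥1 x y
  powerPositive x y (yes _) (no  _) = power≥1 x (- y) ⁻¹
  powerPositive x y (no  _) (yes _) = power≥1 (x ⁻¹) y ⁻¹
  powerPositive x y (no  _) (no  _) = power≥1 (x ⁻¹) (- y)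

  -- Real powers of nonnegative bases, with 0 ^ʳ 0 = 1 and 0 ^ʳ y = 0 otherwise.
  _^ʳ_ : ℝ → ℝ → ℝ
  x ^ʳ y =
    if does (x ≤? 0#)
    then (if does (y ≟ 0#) then 1# else 0#)
    else powerPositive x y (1# ≤? x) (0# ≤? y)

  -- Extended reals, needed for the initial bounds U = +∞ and for maxima over the
  -- (when there is a single arm, empty) set of competitors.
  ℝ± : Set
  ℝ± = ℝ ±

  open AddExtrema _≤_ public using (_≤±_; ≤±-dec; ≤±-isTotalOrder)

  infix 4 _<±_ _<±?_

  _<±_ : ℝ± → ℝ± → Set
  x <± y = ¬ (y ≤± x)

  _<±?_ : ∀ x y → Dec (x <± y)
  x <±? y = ¬? (≤±-dec _≤?_ y x)

  totalOrder± : TotalOrder _ _ _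
  totalOrder± = record { isTotalOrder = ≤±-isTotalOrder isTotalOrder }

  infixl 6 _-ˡ_ _-ʳ_

  _-ˡ_ : ℝ± → ℝ → ℝ±
  ⊥±    -ˡ y = ⊥±
  [ x ] -ˡ y = [ x - y ]
  ⊤±    -ˡ y = ⊤±

  _-ʳ_ : ℝ → ℝ± → ℝ±
  x -ʳ ⊥±    = ⊤±
  x -ʳ [ y ] = [ x - y ]
  x -ʳ ⊤±    = ⊥±

  third : ℝ± → ℝ±
  third ⊥±    = ⊥±
  third [ x ] = [ x / fromℕ 3 ]
  third ⊤±    = ⊤±

  maxOthers : ∀ {k} → Vector ℝ± k → Fin k → ℝ±
  maxOthers {k} g i =
    Extrema.max totalOrder± ⊥± (map g (filter (λ j → ¬? (j Fin.≟ i)) (allFin k)))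

  -- A way of computing argmax, i.e. of breaking ties.
  ArgMax : ℕ → Set
  ArgMax k = (g : Vector ℝ± k) → ∃ λ i → ∀ j → g j ≤± g i

  -- Finite randomised computations, built from uniform draws.
  data Random (A : Set) : Set where
    return  : A → Random A
    uniform : ∀ n → (Fin (suc n) → Random A) → Random A

  𝔼 : ∀ {A} → Random A → (A → ℝ) → ℝ
  𝔼 (return a)    X = X a
  𝔼 (uniform n p) X = sum (λ i → 𝔼 (p i) X) / fromℕ (suc n)

module Bandits (R : Reals) where
  open RealOperations R public

  record Instance (k : ℕ) : Set where
    field
      reward      : Fin k → ℕ → ℝ
      reward-zero : ∀ i → reward i 0 ≈ 0#
      monotone    : ∀ i t → reward i t ≤ reward i (suc t)
      diminishing : ∀ i t → reward i (suc (suc t)) - reward i (suc t)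
                          ≤ reward i (suc t) - reward i t

  module _ {k : ℕ} (I : Instance k) (T : ℕ) where
    open Instance I renaming (reward to f)

    IsBest : Fin k → Set
    IsBest i = ∀ j → f j T ≤ f i T

    gap : Fin k → ℝ±
    gap i⋆ = f i⋆ T -ʳ maxOthers (λ j → [ f j T ]) i⋆

    LE : ℝ → Fin k → Set
    LE β i = ∀ t → t ℕ.≤ T → f i T * (fromℕ t / fromℕ T) ^ʳ β ≤ f i t

    envelopeExponent : ℝ
    envelopeExponent = inf λ β → 0# < β × β ≤ 1# × (∀ i → LE β i)

    γ : Fin k → ℕ → ℝ
    γ i t = f i (suc t) - f i t

    -- Used for t ≥ 1 only.
    △ : Fin k → ℕ → ℝ
    △ i t = (fromℕ T - fromℕ t) * γ i (pred t)

    Cleared : Fin k → ℝ± → ℕ → Set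
    Cleared i ε n = 2 ℕ.≤ n × n ℕ.≤ T × [ △ i n ] ≤± ε

    IsClearingTime : Fin k → ℝ± → ℕ → Set
    IsClearingTime i ε n = Cleared i ε n × (∀ n′ → Cleared i ε n′ → n ℕ.≤ n′)

    GapClearance : Fin k → ℕ → Set
    GapClearance i⋆ B =
      [ 0# ] <± gap i⋆ ×
      ∃ λ h → (∀ i → IsClearingTime i (third (gap i⋆)) (h i)) × ℕList.sum (toList h) ℕ.≤ B

  module PTRR {k : ℕ} (argmax : ArgMax k) (α m τ : ℝ) (g : Fin k → ℕ → ℝ) where

    -- Given the current pull count s of arm i and the remaining number of pulls,
    -- the same data when the arm is left.
    play : Fin k → ℕ → ℕ → ℕ × ℕ
    play i s zero    = s , zero
    play i s (suc n) =
      if does (m * (fromℕ s / τ) ^ʳ α ≤? g i s) then play i (suc s) n else (s , suc n)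

    -- v records the last value reached by each chosen arm, and -∞ for other arms.
    run : ∀ {r} → Vec (Fin k) r → ℕ → Vector ℝ± k → Random (Fin k)
    run {zero}  unused n       v = return (proj₁ (argmax v))
    run {suc r} unused zero    v = return (proj₁ (argmax v))
    run {suc r} unused (suc n) v = uniform r λ j →
      let i        = lookup unused j
          (s , n′) = play i 0 (suc n)
      in run (removeAt unused j) n′ (updateAt v i (const [ g i s ]))

    ptrr : ℕ → Random (Fin k)
    ptrr n = run (Vec.allFin k) n (const ⊥±)

  -- Ties are broken by `ties t` when t pulls have been made in Stage 1, and by
  -- `ties B` in Stage 2.
  module Hybrid {k : ℕ} (I : Instance k) (T : ℕ) (i⋆ : Fin k)
                (ties : ℕ → ArgMax k) (α : ℝ) (B : ℕ) where
    open Instance I renaming (reward to f)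

    lower : (Fin k → ℕ) → Fin k → ℝ
    lower n i with n i
    ... | zero  = 0#
    ... | suc t = f i (suc t)

    upper : (Fin k → ℕ) → Fin k → ℝ±
    upper n i with n i
    ... | zero  = ⊤±
    ... | suc t = [ f i (suc t) + (fromℕ T - fromℕ (suc t)) * (f i (suc t) - f i t) ]

    -- `loop b t n`: b pulls are left before the budget B is reached, t have been
    -- made, of which n i on arm i.  Returns the arm committed to or, failing
    -- that, the final pull counts.
    loop : ℕ → ℕ → (Fin k → ℕ) → Fin k ⊎ (Fin k → ℕ)
    loop zero    t n = inj₂ n
    loop (suc b) t n =
      let î = proj₁ (ties t λ i → [ lower n i ])
          i = proj₁ (ties t λ i → upper n i -ˡ lower n i)
      in if does (maxOthers (upper n) î <±? [ lower n î ])
         then inj₁ î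
         else loop b (suc t) (updateAt n i suc)

    stage1 : Fin k ⊎ (Fin k → ℕ)
    stage1 = loop B 0 (const 0)

    τ′ : ℝ
    τ′ = (fromℕ T - fromℕ B) - fromℕ k

    m′ : ℝ
    m′ = (τ′ / fromℕ T) * f i⋆ T

    stage2 : (Fin k → ℕ) → Random (Fin k)
    stage2 n = PTRR.ptrr (ties B) α m′ τ′ (λ i s → f i (n i ℕ.+ s)) (T ℕ.∸ B)

    hybrid : Random (Fin k)
    hybrid = [ return , stage2 ]′ stage1

{-# OPTIONS --safe #-}

-- Stage 1.  The bounds L ≤ f(T) ≤ U always hold, so a commitment is correct.  An arm
-- pulled at least h times has U − L ≤ Δ/3; if the widest arm is that narrow then so
-- are all, and the best arm is separated from the others.  Hence before commitment
-- only arms with fewer than h pulls are pulled, and at most Σ h pulls are made.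
--
-- Stage 2.  Since f⋆ satisfies LE(α), the arm i⋆ passes every test.  Put y = k^(−α/(1+α)),
-- q₀ = ⌈k y⌉ and consider the first q₀ draws.  If some arm survives more than about
-- τ/(2q₀) tests, its value is already of order m y, because (1/(k y))^α = y.
-- Otherwise half of the horizon is left after these draws, so if i⋆ is among them,
-- which has probability q₀/k ≥ y, concavity gives a value of order m.

module Submission where

open import Defs
open import Algebra.Bundles using (CommutativeRing; RawRing)
import Algebra.Properties.CommutativeMonoid.Sum as Sum
import Algebra.Properties.CommutativeSemiring.Exp as CommutativeSemiringExp
import Algebra.Properties.Ring as RingProperties
import Algebra.Properties.Semiring.Exp as SemiringExp
import Algebra.Properties.Semiring.Mult as SemiringMult
import Algebra.Solver.Ring
open import Algebra.Solver.Ring.AlmostCommutativeRing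
  using (fromCommutativeRing; _-Raw-AlmostCommutative⟶_)
import Algebra.Solver.Ring.NaturalCoefficients.Default as NaturalCoefficients
open import Data.Bool.Base using (if_then_else_)
open import Data.Fin.Base using (Fin; zero; suc; punchIn; punchOut)
import Data.Fin.Properties as Fin
open import Data.List.Base using (allFin)
import Data.List.Extrema as Extrema
open import Data.List.Membership.Propositional.Properties
  using (∈-map⁺; ∈-filter⁺; ∈-filter⁻; ∈-allFin)
import Data.List.Relation.Unary.All as All
import Data.List.Relation.Unary.All.Properties as All
open import Data.Maybe.Base using (Maybe; just; nothing)
open import Data.Nat.Base as ℕ using (ℕ; zero; suc; pred; z≤n; s≤s)
import Data.Nat.ListAction as ℕList
import Data.Nat.Properties as ℕ
open import Data.Nat.Solver using (module +-*-Solver)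
open import Data.Product.Base using (_×_; ∃; ∃₂; _,_; proj₁; proj₂)
open import Data.Product.Properties using (≡-dec)
open import Data.Sum.Base using (_⊎_; inj₁; inj₂; [_,_]′)
open import Data.Vec.Base as Vec using (Vec; lookup; removeAt)
import Data.Vec.Properties as Vec
open import Data.Vec.Functional using (Vector; updateAt; toList)
open import Data.Vec.Functional.Properties using (updateAt-updates; updateAt-minimal)
open import Function.Base using (_∘_; const; id)
open import Relation.Binary.Bundles using (Poset; TotalOrder)
open import Relation.Binary.Construct.Add.Extrema.NonStrict as AddExtrema using ([_])
import Relation.Binary.Construct.Add.Supremum.NonStrict as AddSupremum
open import Relation.Binary.PropositionalEquality.Core as ≡ using (_≡_; _≢_)
import Relation.Binary.Reasoning.PartialOrder as PartialOrderReasoning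
open import Relation.Binary.Structures using (IsDecTotalOrder)
open import Relation.Nullary.Construct.Add.Extrema using ([_]; ⊥±; ⊤±)
open import Relation.Nullary.Decidable using (Dec; yes; no; does; ¬?)
open import Relation.Nullary.Negation using (¬_; contradiction)

-- The expectation is not split into events. Along the tree of draws the inequality q G ≤ r E is
-- carried, where q of the q₀ draws and r arms are left, E is the expected value from there on, and
-- G is the fraction of m′ that i⋆ reaches. A long-surviving rival closes the induction because its
-- value M satisfies q G ≤ r M; as M ≤ G, this relation survives each draw, and M = q₀ G / k makes
-- it an equality at the start.
--
-- An arm left after s + 1 pulls last passed its test at s. The single pulls, one per arm, are paid
-- by the k subtracted in τ′; only the surplus s counts as waste, and at most q₀ surpluses of at
-- most τ/(2 q₀) use up half of τ.
--
-- Real powers are suprema of rational ones, so only inequalities about them are proved, one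
-- admissible exponent p/q at a time. The identity behind the rate becomes: p/q ≤ α implies p/(q +
-- p) ≤ α/(1 + α).

-- A ring solver with integer coefficients.

module IntegerCoefficients {c ℓ} (R : CommutativeRing c ℓ) where
  open CommutativeRing R
  open SemiringMult semiring using (×-homo-+; ×1-homo-*) renaming (_×_ to _·_)
  open RingProperties ring using (-1*x≈-x; -‿involutive; -‿distribʳ-*)
  open import Relation.Binary.Reasoning.Setoid setoid
  open NaturalCoefficients commutativeSemiring using (solve; _:=_; _:+_; _:*_; con)

  private
    -1# : Carrier
    -1# = - 1#

    -1*-1 : -1# * -1# ≈ 1#
    -1*-1 = trans (-1*x≈-x (- 1#)) (-‿involutive 1#)

    reduce : ℕ → ℕ → ℕ × ℕ
    reduce zero    b       = 0 , b
    reduce (suc a) zero    = suc a , 0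
    reduce (suc a) (suc b) = reduce a b

    -- (a , b) stands for the integer a - b; the results of operations are reduced
    -- because the solver compares normal forms syntactically.
    coefficients : RawRing _ _
    coefficients = record
      { Carrier = ℕ × ℕ
      ; _≈_     = _≡_
      ; _+_     = λ (a , b) (c , d) → reduce (a ℕ.+ c) (b ℕ.+ d)
      ; _*_     = λ (a , b) (c , d) → reduce (a ℕ.* c ℕ.+ b ℕ.* d) (a ℕ.* d ℕ.+ b ℕ.* c)
      ; -_      = λ (a , b) → b , a
      ; 0#      = 0 , 0
      ; 1#      = 1 , 0
      }

    -- Subtraction is written with a factor -1, which the semiring solver can treat as a variable;
    -- its only special laws are supplied by hand.
    expand : ℕ × ℕ → Carrier
    expand (a , b) = a · 1# + b · 1# * -1#

    -- The separate clauses for 0 and 1 make these constants evaluate to `0#` and `1#` themselves,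
    -- so that solved equations match goals that mention them.
    ⟦_⟧ : ℕ × ℕ → Carrier
    ⟦ 0 , 0 ⟧ = 0#
    ⟦ 1 , 0 ⟧ = 1#
    ⟦ p ⟧     = expand p

    ⟦⟧-expand : ∀ p → ⟦ p ⟧ ≈ expand p
    ⟦⟧-expand (0 , 0)           = sym (trans (+-identityˡ _) (zeroˡ _))
    ⟦⟧-expand (1 , 0)           =
      solve 1 (λ m → con 1 := (con 1 :+ con 0) :+ con 0 :* m) refl -1#
    ⟦⟧-expand (suc (suc a) , 0) = refl
    ⟦⟧-expand (0 , suc b)       = refl
    ⟦⟧-expand (1 , suc b)       = refl
    ⟦⟧-expand (suc (suc a) , suc b) = refl

    expand-reduce : ∀ a b → expand (reduce a b) ≈ expand (a , b)
    expand-reduce zero    b       = refl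
    expand-reduce (suc a) zero    = refl
    expand-reduce (suc a) (suc b) = begin
      expand (reduce a b)          ≈⟨ expand-reduce a b ⟩
      expand (a , b)               ≈⟨ +-identityˡ _ ⟨
      0# + expand (a , b)          ≈⟨ +-congʳ (-‿inverseʳ 1#) ⟨
      (1# + -1#) + expand (a , b)
        ≈⟨ solve 3 (λ a b m → (con 1 :+ m) :+ (a :+ b :* m)
                           := (con 1 :+ a) :+ (con 1 :+ b) :* m)
             refl (a · 1#) (b · 1#) -1# ⟩
      (1# + a · 1#) + (1# + b · 1#) * -1# ∎

    module C = RawRing coefficients

    +-homo : ∀ p q → ⟦ p C.+ q ⟧ ≈ ⟦ p ⟧ + ⟦ q ⟧
    +-homo p@(a , b) q@(c , d) = begin
      ⟦ p C.+ q ⟧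
        ≈⟨ trans (⟦⟧-expand (p C.+ q)) (expand-reduce (a ℕ.+ c) (b ℕ.+ d)) ⟩
      (a ℕ.+ c) · 1# + (b ℕ.+ d) · 1# * -1#
        ≈⟨ +-cong (×-homo-+ 1# a c) (*-congʳ (×-homo-+ 1# b d)) ⟩
      (a · 1# + c · 1#) + (b · 1# + d · 1#) * -1#
        ≈⟨ solve 5 (λ a b c d m → (a :+ c) :+ (b :+ d) :* m
                               := (a :+ b :* m) :+ (c :+ d :* m))
             refl (a · 1#) (b · 1#) (c · 1#) (d · 1#) -1# ⟩
      expand p + expand q
        ≈⟨ +-cong (⟦⟧-expand p) (⟦⟧-expand q) ⟨
      ⟦ p ⟧ + ⟦ q ⟧ ∎

    *-homo : ∀ p q → ⟦ p C.* q ⟧ ≈ ⟦ p ⟧ * ⟦ q ⟧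
    *-homo p@(a , b) q@(c , d) = begin
      ⟦ p C.* q ⟧
        ≈⟨ trans (⟦⟧-expand (p C.* q)) (expand-reduce (a ℕ.* c ℕ.+ b ℕ.* d) (a ℕ.* d ℕ.+ b ℕ.* c)) ⟩
      (a ℕ.* c ℕ.+ b ℕ.* d) · 1# + (a ℕ.* d ℕ.+ b ℕ.* c) · 1# * -1#
        ≈⟨ +-cong (products a c b d) (*-congʳ (products a d b c)) ⟩
      (A * C + B * D) + (A * D + B * C) * -1#
        ≈⟨ +-congʳ (+-congˡ (trans (sym (*-identityʳ _)) (*-congˡ (sym -1*-1)))) ⟩
      (A * C + B * D * (-1# * -1#)) + (A * D + B * C) * -1#
        ≈⟨ solve 5 (λ a b c d m → (a :* c :+ b :* d :* (m :* m)) :+ (a :* d :+ b :* c) :* m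
                               := (a :+ b :* m) :* (c :+ d :* m))
             refl A B C D -1# ⟩
      expand p * expand q
        ≈⟨ *-cong (⟦⟧-expand p) (⟦⟧-expand q) ⟨
      ⟦ p ⟧ * ⟦ q ⟧ ∎
      where
      A = a · 1#
      B = b · 1#
      C = c · 1#
      D = d · 1#
      products : ∀ a c b d → (a ℕ.* c ℕ.+ b ℕ.* d) · 1# ≈ a · 1# * (c · 1#) + b · 1# * (d · 1#)
      products a c b d = trans (×-homo-+ 1# (a ℕ.* c) (b ℕ.* d))
                               (+-cong (×1-homo-* a c) (×1-homo-* b d))

    -‿homo : ∀ p → ⟦ C.- p ⟧ ≈ - ⟦ p ⟧
    -‿homo p@(a , b) = begin
      ⟦ b , a ⟧
        ≈⟨ ⟦⟧-expand (b , a) ⟩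
      b · 1# + a · 1# * -1#
        ≈⟨ +-congʳ (trans (sym (*-identityʳ _)) (*-congˡ (sym -1*-1))) ⟩
      b · 1# * (-1# * -1#) + a · 1# * -1#
        ≈⟨ solve 3 (λ a b m → b :* (m :* m) :+ a :* m := m :* (a :+ b :* m))
             refl (a · 1#) (b · 1#) -1# ⟩
      -1# * expand p
        ≈⟨ -1*x≈-x _ ⟩
      - expand p
        ≈⟨ -‿cong (⟦⟧-expand p) ⟨
      - ⟦ p ⟧ ∎

    morphism : coefficients -Raw-AlmostCommutative⟶ fromCommutativeRing R
    morphism = record
      { ⟦_⟧ = ⟦_⟧ ; +-homo = +-homo ; *-homo = *-homo ; -‿homo = -‿homo
      ; 0-homo = refl ; 1-homo = refl }

    coefficient≟ : ∀ p q → Maybe (⟦ p ⟧ ≈ ⟦ q ⟧)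
    coefficient≟ p q with ≡-dec ℕ._≟_ ℕ._≟_ p q
    ... | yes p≡q = just (reflexive (≡.cong ⟦_⟧ p≡q))
    ... | no  _   = nothing

  module Solver = Algebra.Solver.Ring coefficients (fromCommutativeRing R) morphism coefficient≟

-- Ordered-field arithmetic, embedded naturals and integer powers.

module OrderedField (R : Reals) where
  open RealOperations R
  open CommutativeRing commutativeRing public
    using ( refl; sym; trans; reflexive; semiring; commutativeSemiring
          ; +-cong; +-congˡ; +-congʳ; *-cong; *-congˡ; *-congʳ; *-comm; *-assoc; +-comm
          ; *-identityˡ; *-identityʳ; +-identityˡ; +-identityʳ; zeroˡ; zeroʳ; -‿cong; -‿inverseʳ)
  open IsDecTotalOrder isDecTotalOrder public
    using (total; antisym)
    renaming (refl to ≤-refl; trans to ≤-trans; reflexive to ≤-reflexive)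

  open IntegerCoefficients.Solver commutativeRing public
    using (solve; _:=_; _:+_; _:*_; _:-_; :-_; con)

  :0 :1 : ∀ {n} → IntegerCoefficients.Solver.Polynomial commutativeRing n
  :0 = con (0 , 0)
  :1 = con (1 , 0)

  poset : Poset _ _ _
  poset = record { isPartialOrder = IsDecTotalOrder.isPartialOrder isDecTotalOrder }

  module ≤-Reasoning = PartialOrderReasoning poset
    using (begin_; step-≤; step-≈-⟩; step-≈-⟨; step-≡-∣; step-≡-⟩; step-≡-⟨; _∎)

  open ≤-Reasoning

  <⇒≤ : ∀ {x y} → x < y → x ≤ y
  <⇒≤ {x} {y} x<y with total x y
  ... | inj₁ x≤y = x≤y
  ... | inj₂ y≤x = contradiction y≤x x<y

  <-≤-trans : ∀ {x y z} → x < y → y ≤ z → x < z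
  <-≤-trans x<y y≤z z≤x = x<y (≤-trans y≤z z≤x)

  <⇒≉ : ∀ {x} → 0# < x → ¬ x ≈ 0#
  <⇒≉ 0<x x≈0 = 0<x (≤-reflexive x≈0)

  +-mono-≤ : ∀ {w x y z} → w ≤ x → y ≤ z → w + y ≤ x + z
  +-mono-≤ {w} {x} {y} {z} w≤x y≤z = begin
    w + y  ≤⟨ +-monoʳ-≤ w y≤z ⟩
    w + z  ≈⟨ +-comm w z ⟩
    z + w  ≤⟨ +-monoʳ-≤ z w≤x ⟩
    z + x  ≈⟨ +-comm z x ⟩
    x + z  ∎

  -- Linear inequalities are derived by exhibiting the slack of the conclusion as
  -- the slack of a combination of hypotheses.
  ≤-by-slack : ∀ {p q x y} → p ≤ q → y - x ≈ q - p → x ≤ y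
  ≤-by-slack {p} {q} {x} {y} p≤q slack = begin
    x                ≈⟨ solve 2 (λ x p → x := (x :- p) :+ p) refl x p ⟩
    (x - p) + p      ≤⟨ +-monoʳ-≤ (x - p) p≤q ⟩
    (x - p) + q      ≈⟨ solve 3 (λ x p q → (x :- p) :+ q := x :+ (q :- p)) refl x p q ⟩
    x + (q - p)      ≈⟨ +-congˡ slack ⟨
    x + (y - x)      ≈⟨ solve 2 (λ x y → x :+ (y :- x) := y) refl x y ⟩
    y                ∎

  0≤y-x : ∀ {x y} → x ≤ y → 0# ≤ y - x
  0≤y-x {x} {y} x≤y =
    ≤-by-slack x≤y (solve 2 (λ x y → (y :- x) :- :0 := y :- x) refl x y)

  *-monoʳ-≤ : ∀ {x y z} → 0# ≤ x → y ≤ z → x * y ≤ x * z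
  *-monoʳ-≤ {x} {y} {z} 0≤x y≤z = ≤-by-slack (*-nonNeg 0≤x (0≤y-x y≤z))
    (solve 3 (λ x y z → x :* z :- x :* y := x :* (z :- y) :- :0) refl x y z)

  *-monoˡ-≤ : ∀ {x y z} → 0# ≤ x → y ≤ z → y * x ≤ z * x
  *-monoˡ-≤ {x} {y} {z} 0≤x y≤z = begin
    y * x  ≈⟨ *-comm y x ⟩
    x * y  ≤⟨ *-monoʳ-≤ 0≤x y≤z ⟩
    x * z  ≈⟨ *-comm x z ⟩
    z * x  ∎

  *-mono-≤ : ∀ {w x y z} → 0# ≤ w → 0# ≤ y → w ≤ x → y ≤ z → w * y ≤ x * z
  *-mono-≤ 0≤w 0≤y w≤x y≤z =
    ≤-trans (*-monoʳ-≤ 0≤w y≤z) (*-monoˡ-≤ (≤-trans 0≤y y≤z) w≤x)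

  0≤1 : 0# ≤ 1#
  0≤1 with total 0# 1#
  ... | inj₁ 0≤1 = 0≤1
  ... | inj₂ 1≤0 = ≤-by-slack (*-nonNeg (0≤y-x 1≤0) (0≤y-x 1≤0))
    (solve 0 (:1 :- :0 := (:0 :- :1) :* (:0 :- :1) :- :0) refl)

  0<1 : 0# < 1#
  0<1 1≤0 = 0≉1 (antisym 0≤1 1≤0)

  *-inverseʳ : ∀ {x} → 0# < x → x * x ⁻¹ ≈ 1#
  *-inverseʳ 0<x = ⁻¹-inverse _ (<⇒≉ 0<x)

  ⁻¹-positive : ∀ {x} → 0# < x → 0# < x ⁻¹
  ⁻¹-positive {x} 0<x x⁻¹≤0 = 0<1 (begin
    1#        ≈⟨ *-inverseʳ 0<x ⟨
    x * x ⁻¹  ≤⟨ *-monoʳ-≤ (<⇒≤ 0<x) x⁻¹≤0 ⟩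
    x * 0#    ≈⟨ zeroʳ x ⟩
    0#        ∎)

  *-cancelˡ-≤ : ∀ {x y z} → 0# < x → x * y ≤ x * z → y ≤ z
  *-cancelˡ-≤ {x} {y} {z} 0<x xy≤xz = begin
    y               ≈⟨ undo y ⟨
    x ⁻¹ * (x * y)  ≤⟨ *-monoʳ-≤ (<⇒≤ (⁻¹-positive 0<x)) xy≤xz ⟩
    x ⁻¹ * (x * z)  ≈⟨ undo z ⟩
    z               ∎
    where
    undo : ∀ y → x ⁻¹ * (x * y) ≈ y
    undo y = trans (solve 3 (λ x i y → i :* (x :* y) := (x :* i) :* y) refl x (x ⁻¹) y)
                   (trans (*-congʳ (*-inverseʳ 0<x)) (*-identityˡ y))

  *-cancelʳ-≤ : ∀ {x y z} → 0# < x → y * x ≤ z * x → y ≤ z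
  *-cancelʳ-≤ {x} {y} {z} 0<x yx≤zx = *-cancelˡ-≤ 0<x (begin
    x * y  ≈⟨ *-comm x y ⟩
    y * x  ≤⟨ yx≤zx ⟩
    z * x  ≈⟨ *-comm z x ⟩
    x * z  ∎)

  *-positive : ∀ {x y} → 0# < x → 0# < y → 0# < x * y
  *-positive {x} {y} 0<x 0<y xy≤0 = 0<y (*-cancelˡ-≤ 0<x (begin
    x * y   ≤⟨ xy≤0 ⟩
    0#      ≈⟨ zeroʳ x ⟨
    x * 0#  ∎))

  /-*-cancel : ∀ {x y} → 0# < y → (x / y) * y ≈ x
  /-*-cancel {x} {y} 0<y =
    trans (solve 3 (λ x y i → (x :* i) :* y := x :* (y :* i)) refl x y (y ⁻¹))
          (trans (*-congˡ (*-inverseʳ 0<y)) (*-identityʳ x))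

  x≤z*y⇒x/y≤z : ∀ {x y z} → 0# < y → x ≤ z * y → x / y ≤ z
  x≤z*y⇒x/y≤z 0<y x≤zy =
    *-cancelʳ-≤ 0<y (≤-trans (≤-reflexive (/-*-cancel 0<y)) x≤zy)

  z*y≤x⇒z≤x/y : ∀ {x y z} → 0# < y → z * y ≤ x → z ≤ x / y
  z*y≤x⇒z≤x/y 0<y zy≤x =
    *-cancelʳ-≤ 0<y (≤-trans zy≤x (≤-reflexive (sym (/-*-cancel 0<y))))

  0≤x/y : ∀ {x y} → 0# ≤ x → 0# < y → 0# ≤ x / y
  0≤x/y 0≤x 0<y = *-nonNeg 0≤x (<⇒≤ (⁻¹-positive 0<y))

  ⁻¹-antitone : ∀ {x y} → 0# < x → x ≤ y → y ⁻¹ ≤ x ⁻¹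
  ⁻¹-antitone {x} {y} 0<x x≤y = *-cancelˡ-≤ 0<x (begin
    x * y ⁻¹  ≤⟨ *-monoˡ-≤ (<⇒≤ (⁻¹-positive 0<y)) x≤y ⟩
    y * y ⁻¹  ≈⟨ *-inverseʳ 0<y ⟩
    1#        ≈⟨ *-inverseʳ 0<x ⟨
    x * x ⁻¹  ∎)
    where 0<y = <-≤-trans 0<x x≤y

  ⁻¹-unique : ∀ {x y} → 0# < x → x * y ≈ 1# → y ≈ x ⁻¹
  ⁻¹-unique {x} {y} 0<x xy≈1 = antisym (*-cancelˡ-≤ 0<x (≤-reflexive xy≈xx⁻¹))
                                        (*-cancelˡ-≤ 0<x (≤-reflexive (sym xy≈xx⁻¹)))
    where xy≈xx⁻¹ = trans xy≈1 (sym (*-inverseʳ 0<x))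

  ⁻¹-involutive : ∀ {x} → 0# < x → x ≈ (x ⁻¹) ⁻¹
  ⁻¹-involutive 0<x =
    ⁻¹-unique (⁻¹-positive 0<x) (trans (*-comm _ _) (*-inverseʳ 0<x))

  x≤1⇒1≤x⁻¹ : ∀ {x} → 0# < x → x ≤ 1# → 1# ≤ x ⁻¹
  x≤1⇒1≤x⁻¹ {x} 0<x x≤1 = *-cancelˡ-≤ 0<x (begin
    x * 1#    ≈⟨ *-identityʳ x ⟩
    x         ≤⟨ x≤1 ⟩
    1#        ≈⟨ *-inverseʳ 0<x ⟨
    x * x ⁻¹  ∎)

  open SemiringMult semiring using (×-homo-+; ×1-homo-*)

  fromℕ-+ : ∀ m n → fromℕ (m ℕ.+ n) ≈ fromℕ m + fromℕ n
  fromℕ-+ = ×-homo-+ 1#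

  fromℕ-* : ∀ m n → fromℕ (m ℕ.* n) ≈ fromℕ m * fromℕ n
  fromℕ-* = ×1-homo-*

  fromℕ-nonNeg : ∀ n → 0# ≤ fromℕ n
  fromℕ-nonNeg zero    = ≤-refl
  fromℕ-nonNeg (suc n) = ≤-trans (≤-reflexive (sym (+-identityˡ 0#)))
                                 (+-mono-≤ 0≤1 (fromℕ-nonNeg n))

  fromℕ-mono-≤ : ∀ {m n} → m ℕ.≤ n → fromℕ m ≤ fromℕ n
  fromℕ-mono-≤ {n = n} z≤n       = fromℕ-nonNeg n
  fromℕ-mono-≤         (s≤s m≤n) = +-monoʳ-≤ 1# (fromℕ-mono-≤ m≤n)

  n≤1+n : ∀ x → x ≤ 1# + x
  n≤1+n x = ≤-by-slack 0≤1 (solve 1 (λ x → (:1 :+ x) :- x := :1 :- :0) refl x)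

  fromℕ-cancel-≤ : ∀ {m n} → fromℕ m ≤ fromℕ n → m ℕ.≤ n
  fromℕ-cancel-≤ {m} {n} m≤n with m ℕ.≤? n
  ... | yes p  = p
  ... | no m≰n = contradiction
    (≤-by-slack (≤-trans (fromℕ-mono-≤ (ℕ.≰⇒> m≰n)) m≤n)
      (solve 1 (λ n → :0 :- :1 := n :- (:1 :+ n)) refl (fromℕ n)))
    0<1

  fromℕ-positive : ∀ {n} → 1 ℕ.≤ n → 0# < fromℕ n
  fromℕ-positive 1≤n =
    <-≤-trans 0<1 (≤-trans (≤-reflexive (sym (+-identityʳ 1#))) (fromℕ-mono-≤ 1≤n))

  fromℕ-∸ : ∀ {m n} → m ℕ.≤ n → fromℕ n - fromℕ m ≈ fromℕ (n ℕ.∸ m)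
  fromℕ-∸ {m} {n} m≤n = trans
      (+-congʳ (trans (reflexive (≡.cong fromℕ (≡.sym (ℕ.m+[n∸m]≡n m≤n)))) (fromℕ-+ m (n ℕ.∸ m))))
      (solve 2 (λ m d → (m :+ d) :- m := d) refl (fromℕ m) (fromℕ (n ℕ.∸ m)))

  -- A downward search starting at the given bound. The conclusion `q ≤ n` is kept because the
  -- number of draws may not exceed the number of arms.
  ceiling : ∀ {x} → 0# ≤ x → ∀ n → x ≤ fromℕ n →
            ∃ λ q → q ℕ.≤ n × x ≤ fromℕ q × fromℕ q ≤ 1# + x
  ceiling {x} 0≤x zero    x≤0 = zero , z≤n , x≤0 , ≤-trans 0≤x (n≤1+n x)
  ceiling {x} 0≤x (suc n) x≤1+n with x ≤? fromℕ n
  ... | no  n<x = suc n , ℕ.≤-refl , x≤1+n , +-monoʳ-≤ 1# (<⇒≤ n<x)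
  ... | yes x≤n with q , q≤n , bounds ← ceiling 0≤x n x≤n = q , ℕ.m≤n⇒m≤1+n q≤n , bounds

  open SemiringExp semiring public using (^-congˡ; ^-homo-*)
  open CommutativeSemiringExp commutativeSemiring public using (^-distrib-*)

  ^-nonNeg : ∀ {x} n → 0# ≤ x → 0# ≤ x ^ n
  ^-nonNeg zero    0≤x = 0≤1
  ^-nonNeg (suc n) 0≤x = *-nonNeg 0≤x (^-nonNeg n 0≤x)

  ^-positive : ∀ {x} n → 0# < x → 0# < x ^ n
  ^-positive zero    0<x = 0<1
  ^-positive (suc n) 0<x = *-positive 0<x (^-positive n 0<x)

  ^-mono-≤ : ∀ {x y} n → 0# ≤ x → x ≤ y → x ^ n ≤ y ^ n
  ^-mono-≤ zero    0≤x x≤y = ≤-refl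
  ^-mono-≤ (suc n) 0≤x x≤y = *-mono-≤ 0≤x (^-nonNeg n 0≤x) x≤y (^-mono-≤ n 0≤x x≤y)

  ^-cancel-≤ : ∀ {x y} n → 0# ≤ y → x ^ suc n ≤ y ^ suc n → x ≤ y
  ^-cancel-≤ {x} {y} n 0≤y x^n≤y^n with x ≤? y
  ... | yes x≤y = x≤y
  ... | no  y<x = *-cancelʳ-≤ (^-positive n (λ x≤0 → y<x (≤-trans x≤0 0≤y)))
    (≤-trans x^n≤y^n (*-monoʳ-≤ 0≤y (^-mono-≤ n 0≤y (<⇒≤ y<x))))

  1^n≈1 : ∀ n → 1# ^ n ≈ 1#
  1^n≈1 zero    = refl
  1^n≈1 (suc n) = trans (*-identityˡ _) (1^n≈1 n)

  1≤x^n : ∀ {x} n → 1# ≤ x → 1# ≤ x ^ n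
  1≤x^n n 1≤x = ≤-trans (≤-reflexive (sym (1^n≈1 n))) (^-mono-≤ n 0≤1 1≤x)

  ^-monoʳ-≤ : ∀ {x m n} → 1# ≤ x → m ℕ.≤ n → x ^ m ≤ x ^ n
  ^-monoʳ-≤ {n = n} 1≤x z≤n       = 1≤x^n n 1≤x
  ^-monoʳ-≤         1≤x (s≤s m≤n) = *-monoʳ-≤ (≤-trans 0≤1 1≤x) (^-monoʳ-≤ 1≤x m≤n)

  ^-antitoneʳ-≤ : ∀ {x m n} → 0# ≤ x → x ≤ 1# → m ℕ.≤ n → x ^ n ≤ x ^ m
  ^-antitoneʳ-≤ {n = n} 0≤x x≤1 z≤n =
    ≤-trans (^-mono-≤ n 0≤x x≤1) (≤-reflexive (1^n≈1 n))
  ^-antitoneʳ-≤ 0≤x x≤1 (s≤s m≤n) = *-monoʳ-≤ 0≤x (^-antitoneʳ-≤ 0≤x x≤1 m≤n)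

  -- √r is approximated from below by 1 + min(1, (r - 1) / 3).
  1<w²≤r : ∀ {r} → 1# < r → ∃ λ w → 1# < w × w * w ≤ r
  1<w²≤r {r} 1<r = go (total 1# e)
    where
    0<3 = fromℕ-positive {3} (s≤s z≤n)
    e = (r - 1#) / fromℕ 3
    e*3 : e * fromℕ 3 ≈ r - 1#
    e*3 = /-*-cancel 0<3
    0<r-1 : 0# < r - 1#
    0<r-1 r-1≤0 = 1<r (≤-by-slack r-1≤0 (solve 1 (λ r → :1 :- r := :0 :- (r :- :1)) refl r))
    0<e = *-positive 0<r-1 (⁻¹-positive 0<3)
    1<1+ : ∀ {d} → 0# < d → 1# < 1# + d
    1<1+ {d} 0<d 1+d≤1 =
      0<d (≤-by-slack 1+d≤1 (solve 1 (λ d → :0 :- d := :1 :- (:1 :+ d)) refl d))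
    go : 1# ≤ e ⊎ e ≤ 1# → ∃ λ w → 1# < w × w * w ≤ r
    go (inj₁ 1≤e) = 1# + 1# , 1<1+ 0<1 ,
      ≤-by-slack (*-monoˡ-≤ (fromℕ-nonNeg 3) 1≤e) (trans
        (solve 1 (λ r → r :- (:1 :+ :1) :* (:1 :+ :1)
                     := (r :- :1) :- :1 :* (:1 :+ (:1 :+ (:1 :+ :0)))) refl r)
        (+-congʳ (sym e*3)))
    go (inj₂ e≤1) = 1# + e , 1<1+ 0<e ,
      ≤-by-slack (*-monoʳ-≤ (<⇒≤ 0<e) e≤1) (trans
        (solve 2 (λ r e → r :- (:1 :+ e) :* (:1 :+ e)
                       := (r :- :1) :- (e :+ e :+ e :* e)) refl r e)
        (trans (+-congʳ (sym e*3))
          (solve 1 (λ e → e :* (:1 :+ (:1 :+ (:1 :+ :0))) :- (e :+ e :+ e :* e)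
                       := e :* :1 :- e :* e) refl e)))

  -- If s * s ≤ r and w ^ n ≤ s, then the smaller of w and s has its power with exponent `suc n`
  -- bounded by s * s.
  1<w^n≤r : ∀ {r} n → 1# < r → ∃ λ w → 1# < w × w ^ n ≤ r
  1<w^n≤r zero    1<r = _ , 1<r , <⇒≤ 1<r
  1<w^n≤r (suc n) 1<r with 1<w²≤r 1<r
  ... | s , 1<s , s²≤r with 1<w^n≤r n 1<s
  ... | w , 1<w , w^n≤s with total w s
  ... | inj₁ w≤s = w , 1<w , ≤-trans
    (*-mono-≤ 0≤w (^-nonNeg n 0≤w) w≤s w^n≤s) s²≤r
    where 0≤w = ≤-trans 0≤1 (<⇒≤ 1<w)
  ... | inj₂ s≤w = s , 1<s , ≤-trans
    (*-mono-≤ 0≤s (^-nonNeg n 0≤s) ≤-refl (≤-trans (^-mono-≤ n 0≤s s≤w) w^n≤s)) s²≤r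
    where 0≤s = ≤-trans 0≤1 (<⇒≤ 1<s)

-- Real powers with exponents in [0, 1].

module RealPowers (R : Reals) where
  open RealOperations R
  open OrderedField R
  open ≤-Reasoning

  p≤qy⇒p≤q : ∀ p q {y} → y ≤ 1# → fromℕ p ≤ fromℕ q * y → p ℕ.≤ q
  p≤qy⇒p≤q p q {y} y≤1 p≤qy = fromℕ-cancel-≤ (begin
    fromℕ p       ≤⟨ p≤qy ⟩
    fromℕ q * y   ≤⟨ *-monoʳ-≤ (fromℕ-nonNeg q) y≤1 ⟩
    fromℕ q * 1#  ≈⟨ *-identityʳ _ ⟩
    fromℕ q       ∎)

  -- A member lies below the supremum only if the set is bounded. Exponents at most 1 force p ≤
  -- `suc q`, which makes `x` itself a bound; α and α/(1+α) are such exponents.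
  ≤-power≥1 : ∀ {x y z} p q → 1# ≤ x → y ≤ 1# → 0# ≤ z →
              fromℕ p ≤ fromℕ (suc q) * y → z ^ suc q ≤ x ^ p → z ≤ power≥1 x y
  ≤-power≥1 {x} {y} p q 1≤x y≤1 0≤z p≤qy z^q≤x^p =
    sup-upper _ (x , bound) _ (0≤z , p , q , p≤qy , z^q≤x^p)
    where
    bound : ∀ z → 0# ≤ z × (∃₂ λ p q → fromℕ p ≤ fromℕ (suc q) * y × z ^ suc q ≤ x ^ p) → z ≤ x
    bound z (_ , p , q , p≤qy , z^q≤x^p) = ^-cancel-≤ q (≤-trans 0≤1 1≤x)
      (≤-trans z^q≤x^p (^-monoʳ-≤ 1≤x (p≤qy⇒p≤q p (suc q) y≤1 p≤qy)))

  -- The member that `sup-least` asks for is z = 1, with exponent 0/1.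
  power≥1-≤ : ∀ {x y u} → 0# ≤ y →
              (∀ z p q → 0# ≤ z → fromℕ p ≤ fromℕ (suc q) * y → z ^ suc q ≤ x ^ p → z ≤ u) →
              power≥1 x y ≤ u
  power≥1-≤ {x} {y} 0≤y bound = sup-least _
    (1# , 0≤1 , 0 , 0 , *-nonNeg (fromℕ-nonNeg 1) 0≤y , ≤-reflexive (1^n≈1 1))
    _ λ z (0≤z , p , q , p≤qy , z^q≤x^p) → bound z p q 0≤z p≤qy z^q≤x^p

  1≤power≥1 : ∀ {x y} → 1# ≤ x → 0# ≤ y → y ≤ 1# → 1# ≤ power≥1 x y
  1≤power≥1 1≤x 0≤y y≤1 =
    ≤-power≥1 0 0 1≤x y≤1 0≤1 (*-nonNeg (fromℕ-nonNeg 1) 0≤y) (≤-reflexive (1^n≈1 1))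

  0<power≥1 : ∀ {x y} → 1# ≤ x → 0# ≤ y → y ≤ 1# → 0# < power≥1 x y
  0<power≥1 1≤x 0≤y y≤1 = <-≤-trans 0<1 (1≤power≥1 1≤x 0≤y y≤1)

  power≥1-mono-≤ : ∀ {x y y′} → 1# ≤ x → 0# ≤ y → y ≤ y′ → y′ ≤ 1# →
                   power≥1 x y ≤ power≥1 x y′
  power≥1-mono-≤ 1≤x 0≤y y≤y′ y′≤1 = power≥1-≤ 0≤y λ z p q 0≤z p≤qy z^q≤x^p →
    ≤-power≥1 p q 1≤x y′≤1 0≤z
      (≤-trans p≤qy (*-monoʳ-≤ (fromℕ-nonNeg (suc q)) y≤y′)) z^q≤x^p

  power≥1-1 : ∀ {x} → 1# ≤ x → x ≤ power≥1 x 1#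
  power≥1-1 1≤x = ≤-power≥1 1 0 1≤x ≤-refl (≤-trans 0≤1 1≤x)
    (≤-reflexive (sym (*-identityʳ _))) ≤-refl

  power≥1-≤-base : ∀ {x y} → 1# ≤ x → 0# ≤ y → y ≤ 1# → power≥1 x y ≤ x
  power≥1-≤-base 1≤x 0≤y y≤1 = power≥1-≤ 0≤y λ z p q 0≤z p≤qy z^q≤x^p →
    ^-cancel-≤ q (≤-trans 0≤1 1≤x) (≤-trans z^q≤x^p (^-monoʳ-≤ 1≤x (p≤qy⇒p≤q p (suc q) y≤1 p≤qy)))

  -- If the supremum Y defining the power had Y^n < x^p, then Y·w would also
  -- belong to the set for some w > 1.
  power≥1-root : ∀ {x y} p n → 1# ≤ x → 0# ≤ y → y ≤ 1# →
                 fromℕ p ≤ fromℕ (suc n) * y → x ^ p ≤ power≥1 x y ^ suc n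
  power≥1-root {x} {y} p n 1≤x 0≤y y≤1 p≤ny with x ^ p ≤? power≥1 x y ^ suc n
  ... | yes x^p≤Y^n = x^p≤Y^n
  ... | no  Y^n<x^p = contradiction (*-cancelˡ-≤ 0<Y Yw≤Y·1) 1<w
    where
    Y = power≥1 x y
    0<Y = 0<power≥1 1≤x 0≤y y≤1
    0<Y^n = ^-positive (suc n) 0<Y
    r = x ^ p / Y ^ suc n
    1<r : 1# < r
    1<r r≤1 = Y^n<x^p (begin
      x ^ p          ≈⟨ /-*-cancel 0<Y^n ⟨
      r * Y ^ suc n  ≤⟨ *-monoˡ-≤ (<⇒≤ 0<Y^n) r≤1 ⟩
      1# * Y ^ suc n ≈⟨ *-identityˡ _ ⟩
      Y ^ suc n      ∎)
    w = proj₁ (1<w^n≤r (suc n) 1<r)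
    1<w = proj₁ (proj₂ (1<w^n≤r (suc n) 1<r))
    w^n≤r = proj₂ (proj₂ (1<w^n≤r (suc n) 1<r))
    Yw≤Y·1 : Y * w ≤ Y * 1#
    Yw≤Y·1 = ≤-trans
      (≤-power≥1 p n 1≤x y≤1 (*-nonNeg (<⇒≤ 0<Y) (≤-trans 0≤1 (<⇒≤ 1<w))) p≤ny (begin
        (Y * w) ^ suc n        ≈⟨ ^-distrib-* Y w (suc n) ⟩
        Y ^ suc n * w ^ suc n  ≤⟨ *-monoʳ-≤ (<⇒≤ 0<Y^n) w^n≤r ⟩
        Y ^ suc n * r          ≈⟨ *-comm _ _ ⟩
        r * Y ^ suc n          ≈⟨ /-*-cancel 0<Y^n ⟩
        x ^ p                  ∎))
      (≤-reflexive (sym (*-identityʳ Y)))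

  ^ʳ-base≤0 : ∀ {x y} → x ≤ 0# → 0# < y → x ^ʳ y ≡ 0#
  ^ʳ-base≤0 {x} {y} x≤0 0<y with x ≤? 0# | y ≟ 0#
  ... | yes _   | no  _   = ≡.refl
  ... | yes _   | yes y≈0 = contradiction y≈0 (<⇒≉ 0<y)
  ... | no  0<x | _       = contradiction x≤0 0<x

  ^ʳ-base≥1 : ∀ {x y} → 1# ≤ x → 0# ≤ y → x ^ʳ y ≡ power≥1 x y
  ^ʳ-base≥1 {x} {y} 1≤x 0≤y with x ≤? 0# | 1# ≤? x | 0# ≤? y
  ... | yes x≤0 | _       | _       = contradiction (≤-trans 1≤x x≤0) 0<1
  ... | no  _   | yes _   | yes _   = ≡.refl
  ... | no  _   | no  x<1 | _       = contradiction 1≤x x<1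
  ... | no  _   | yes _   | no  y<0 = contradiction 0≤y y<0

  ^ʳ-base<1 : ∀ {x y} → 0# < x → x < 1# → 0# ≤ y → x ^ʳ y ≡ power≥1 (x ⁻¹) y ⁻¹
  ^ʳ-base<1 {x} {y} 0<x x<1 0≤y with x ≤? 0# | 1# ≤? x | 0# ≤? y
  ... | yes x≤0 | _       | _       = contradiction x≤0 0<x
  ... | no  _   | no  _   | yes _   = ≡.refl
  ... | no  _   | yes 1≤x | _       = contradiction 1≤x x<1
  ... | no  _   | no  _   | no  y<0 = contradiction 0≤y y<0

  ^ʳ-negative : ∀ {x y} → 1# ≤ x → y < 0# → x ^ʳ y ≡ power≥1 x (- y) ⁻¹
  ^ʳ-negative {x} {y} 1≤x y<0 with x ≤? 0# | 1# ≤? x | 0# ≤? y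
  ... | yes x≤0 | _       | _       = contradiction (≤-trans 1≤x x≤0) 0<1
  ... | no  _   | yes _   | no  _   = ≡.refl
  ... | no  _   | no  x<1 | _       = contradiction 1≤x x<1
  ... | no  _   | yes _   | yes 0≤y = contradiction 0≤y y<0

  data BaseView (x : ℝ) : Set where
    base≤0 : x ≤ 0# → BaseView x
    base<1 : 0# < x → x < 1# → BaseView x
    base≥1 : 1# ≤ x → BaseView x

  baseView : ∀ x → BaseView x
  baseView x with x ≤? 0# | 1# ≤? x
  ... | yes x≤0 | _       = base≤0 x≤0
  ... | no  _   | yes 1≤x = base≥1 1≤x
  ... | no  0<x | no  x<1 = base<1 0<x x<1

  1≤x⁻¹ : ∀ {x} → 0# < x → x < 1# → 1# ≤ x ⁻¹
  1≤x⁻¹ 0<x x<1 = x≤1⇒1≤x⁻¹ 0<x (<⇒≤ x<1)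

  1≤^ʳ : ∀ {x y} → 1# ≤ x → 0# ≤ y → y ≤ 1# → 1# ≤ x ^ʳ y
  1≤^ʳ {x} {y} 1≤x 0≤y y≤1 = begin
    1#           ≤⟨ 1≤power≥1 1≤x 0≤y y≤1 ⟩
    power≥1 x y  ≡⟨ ^ʳ-base≥1 1≤x 0≤y ⟨
    x ^ʳ y       ∎

  ^ʳ≤base : ∀ {x y} → 1# ≤ x → 0# ≤ y → y ≤ 1# → x ^ʳ y ≤ x
  ^ʳ≤base {x} {y} 1≤x 0≤y y≤1 = begin
    x ^ʳ y       ≡⟨ ^ʳ-base≥1 1≤x 0≤y ⟩
    power≥1 x y  ≤⟨ power≥1-≤-base 1≤x 0≤y y≤1 ⟩
    x            ∎

  base≤^ʳ : ∀ {x y} → x ≤ 1# → 0# < y → y ≤ 1# → x ≤ x ^ʳ y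
  base≤^ʳ {x} {y} x≤1 0<y y≤1 with baseView x
  ... | base≤0 x≤0 = ≤-trans x≤0 (≤-reflexive (reflexive (≡.sym (^ʳ-base≤0 x≤0 0<y))))
  ... | base≥1 1≤x = ≤-trans x≤1 (1≤^ʳ 1≤x (<⇒≤ 0<y) y≤1)
  ... | base<1 0<x x<1 = begin
    x                     ≈⟨ ⁻¹-involutive 0<x ⟩
    (x ⁻¹) ⁻¹             ≤⟨ ⁻¹-antitone (0<power≥1 1≤1/x (<⇒≤ 0<y) y≤1)
                                          (power≥1-≤-base 1≤1/x (<⇒≤ 0<y) y≤1) ⟩
    power≥1 (x ⁻¹) y ⁻¹   ≡⟨ ^ʳ-base<1 0<x x<1 (<⇒≤ 0<y) ⟨
    x ^ʳ y                ∎
    where 1≤1/x = 1≤x⁻¹ 0<x x<1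

  ^ʳ-antitone : ∀ {x y y′} → x ≤ 1# → 0# < y → y ≤ y′ → y′ ≤ 1# → x ^ʳ y′ ≤ x ^ʳ y
  ^ʳ-antitone {x} {y} {y′} x≤1 0<y y≤y′ y′≤1 with baseView x
  ... | base≤0 x≤0 = ≤-reflexive (reflexive
    (≡.trans (^ʳ-base≤0 x≤0 (<-≤-trans 0<y y≤y′)) (≡.sym (^ʳ-base≤0 x≤0 0<y))))
  ... | base≥1 1≤x = begin
    x ^ʳ y′  ≤⟨ ^ʳ≤base 1≤x (≤-trans (<⇒≤ 0<y) y≤y′) y′≤1 ⟩
    x        ≤⟨ x≤1 ⟩
    1#       ≤⟨ 1≤^ʳ 1≤x (<⇒≤ 0<y) (≤-trans y≤y′ y′≤1) ⟩
    x ^ʳ y   ∎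
  ... | base<1 0<x x<1 = begin
    x ^ʳ y′               ≡⟨ ^ʳ-base<1 0<x x<1 (≤-trans (<⇒≤ 0<y) y≤y′) ⟩
    power≥1 (x ⁻¹) y′ ⁻¹  ≤⟨ ⁻¹-antitone (0<power≥1 1≤1/x (<⇒≤ 0<y) (≤-trans y≤y′ y′≤1))
                                          (power≥1-mono-≤ 1≤1/x (<⇒≤ 0<y) y≤y′ y′≤1) ⟩
    power≥1 (x ⁻¹) y ⁻¹   ≡⟨ ^ʳ-base<1 0<x x<1 (<⇒≤ 0<y) ⟨
    x ^ʳ y                ∎
    where 1≤1/x = 1≤x⁻¹ 0<x x<1

  ^ʳ-1 : ∀ {x} → 0# ≤ x → x ≤ 1# → x ^ʳ 1# ≤ x
  ^ʳ-1 {x} 0≤x x≤1 with baseView x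
  ... | base≤0 x≤0 = ≤-trans (≤-reflexive (reflexive (^ʳ-base≤0 x≤0 0<1))) 0≤x
  ... | base≥1 1≤x = ^ʳ≤base 1≤x 0≤1 ≤-refl
  ... | base<1 0<x x<1 = begin
    x ^ʳ 1#                ≡⟨ ^ʳ-base<1 0<x x<1 0≤1 ⟩
    power≥1 (x ⁻¹) 1# ⁻¹   ≤⟨ ⁻¹-antitone (⁻¹-positive 0<x) (power≥1-1 (1≤x⁻¹ 0<x x<1)) ⟩
    (x ⁻¹) ⁻¹              ≈⟨ ⁻¹-involutive 0<x ⟨
    x                      ∎

  -- u ≤ u^α for u ≤ 1, so (u·x)^α = u^α·x^α ≥ u·x^α.
  *-^ʳ-≤ : ∀ {u x w α} → 0# < u → u ≤ 1# → w ≈ u * x → w ≤ 1# → 0# < α → α ≤ 1# →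
           u * x ^ʳ α ≤ w ^ʳ α
  *-^ʳ-≤ {u} {x} {w} {α} 0<u u≤1 w≈ux w≤1 0<α α≤1 with baseView x
  ... | base≤0 x≤0 = begin
    u * x ^ʳ α  ≈⟨ *-congˡ (reflexive (^ʳ-base≤0 x≤0 0<α)) ⟩
    u * 0#      ≈⟨ zeroʳ u ⟩
    0#          ≡⟨ ^ʳ-base≤0 w≤0 0<α ⟨
    w ^ʳ α      ∎
    where
    w≤0 : w ≤ 0#
    w≤0 = begin
      w       ≈⟨ w≈ux ⟩
      u * x   ≤⟨ *-monoʳ-≤ (<⇒≤ 0<u) x≤0 ⟩
      u * 0#  ≈⟨ zeroʳ u ⟩
      0#      ∎
  ... | base≥1 1≤x = begin
    u * x ^ʳ α  ≤⟨ *-monoʳ-≤ (<⇒≤ 0<u) (^ʳ≤base 1≤x (<⇒≤ 0<α) α≤1) ⟩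
    u * x       ≈⟨ w≈ux ⟨
    w           ≤⟨ base≤^ʳ w≤1 0<α α≤1 ⟩
    w ^ʳ α      ∎
  ... | base<1 0<x x<1 = begin
    u * x ^ʳ α                 ≡⟨ ≡.cong (u *_) (^ʳ-base<1 0<x x<1 0≤α) ⟩
    u / X                      ≤⟨ x≤z*y⇒x/y≤z 0<X u≤W⁻¹X ⟩
    W ⁻¹                       ≡⟨ ^ʳ-base<1 0<w w<1 0≤α ⟨
    w ^ʳ α                     ∎
    where
    0≤α = <⇒≤ 0<α
    0≤u = <⇒≤ 0<u
    0<w : 0# < w
    0<w w≤0 = *-positive 0<u 0<x (≤-trans (≤-reflexive (sym w≈ux)) w≤0)
    w≤x : w ≤ x
    w≤x = begin
      w       ≈⟨ w≈ux ⟩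
      u * x   ≤⟨ *-monoˡ-≤ (<⇒≤ 0<x) u≤1 ⟩
      1# * x  ≈⟨ *-identityˡ x ⟩
      x       ∎
    w<1 : w < 1#
    w<1 1≤w = x<1 (≤-trans 1≤w w≤x)
    1≤1/x = 1≤x⁻¹ 0<x x<1
    1≤1/w = 1≤x⁻¹ 0<w w<1
    X = power≥1 (x ⁻¹) α
    W = power≥1 (w ⁻¹) α
    0<X = 0<power≥1 1≤1/x 0≤α α≤1
    0<W = 0<power≥1 1≤1/w 0≤α α≤1
    u/w≈1/x : u * w ⁻¹ ≈ x ⁻¹
    u/w≈1/x = ⁻¹-unique 0<x (trans
      (solve 3 (λ x u i → x :* (u :* i) := (u :* x) :* i) refl x u (w ⁻¹))
      (trans (*-congʳ (sym w≈ux)) (*-inverseʳ 0<w)))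
    W≤X/u : W ≤ X / u
    W≤X/u = power≥1-≤ 0≤α λ z p q 0≤z p≤qα z^q≤w^-p → z*y≤x⇒z≤x/y 0<u
      (≤-power≥1 p q 1≤1/x α≤1 (*-nonNeg 0≤z 0≤u) p≤qα (begin
        (z * u) ^ suc q         ≈⟨ ^-distrib-* z u (suc q) ⟩
        z ^ suc q * u ^ suc q   ≤⟨ *-mono-≤ (^-nonNeg (suc q) 0≤z) (^-nonNeg (suc q) 0≤u) z^q≤w^-p
                                    (^-antitoneʳ-≤ 0≤u u≤1 (p≤qy⇒p≤q p (suc q) α≤1 p≤qα)) ⟩
        (w ⁻¹) ^ p * u ^ p      ≈⟨ *-comm _ _ ⟩
        u ^ p * (w ⁻¹) ^ p      ≈⟨ ^-distrib-* u (w ⁻¹) p ⟨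
        (u * w ⁻¹) ^ p          ≈⟨ ^-congˡ p u/w≈1/x ⟩
        (x ⁻¹) ^ p              ∎))
    u≤W⁻¹X : u ≤ W ⁻¹ * X
    u≤W⁻¹X = ≤-trans (z*y≤x⇒z≤x/y 0<W (begin
      u * W        ≈⟨ *-comm u W ⟩
      W * u        ≤⟨ *-monoˡ-≤ 0≤u W≤X/u ⟩
      (X / u) * u  ≈⟨ /-*-cancel 0<u ⟩
      X            ∎)) (≤-reflexive (*-comm X (W ⁻¹)))

  -- The exponent α/(1+α).

  module OptimalExponent {k α : ℝ} (1≤k : 1# ≤ k) (0<α : 0# < α) (α≤1 : α ≤ 1#) where
    private
      0≤α = <⇒≤ 0<α
      0<1+α : 0# < 1# + α
      0<1+α = <-≤-trans 0<1 (≤-by-slack 0≤α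
        (solve 1 (λ a → (:1 :+ a) :- :1 := a :- :0) refl α))

    a : ℝ
    a = α / (1# + α)

    k^-a : ℝ
    k^-a = k ^ʳ (- a)

    private
      0<a : 0# < a
      0<a = *-positive 0<α (⁻¹-positive 0<1+α)

      -- A power with exponent `- a` unfolds to one with exponent `- (- a)`, which is a only up to
      -- `≈`. The bounds are transported to `- (- a)` so that `Y` is literally the unfolded
      -- expression.
      a′≈a : - (- a) ≈ a
      a′≈a = solve 1 (λ a → :- (:- a) := a) refl a

      0≤a′ : 0# ≤ - (- a)
      0≤a′ = ≤-trans (<⇒≤ 0<a) (≤-reflexive (sym a′≈a))

      a′≤1 : - (- a) ≤ 1#
      a′≤1 = ≤-trans (≤-reflexive a′≈a) (x≤z*y⇒x/y≤z 0<1+α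
        (≤-by-slack 0≤1 (solve 1 (λ a → :1 :* (:1 :+ a) :- a := :1 :- :0) refl α)))

      -a<0 : - a < 0#
      -a<0 0≤-a = 0<a (≤-by-slack 0≤-a (solve 1 (λ a → :0 :- a := :- a :- :0) refl a))

      Y : ℝ
      Y = power≥1 k (- (- a))

      0<Y = 0<power≥1 1≤k 0≤a′ a′≤1

    k^-a≡ : k^-a ≡ Y ⁻¹
    k^-a≡ = ^ʳ-negative 1≤k -a<0

    k^-a*Y : k^-a * Y ≈ 1#
    k^-a*Y = trans (*-congʳ (reflexive k^-a≡)) (trans (*-comm _ _) (*-inverseʳ 0<Y))

    0<k^-a : 0# < k^-a
    0<k^-a k^-a≤0 = ⁻¹-positive 0<Y (≤-trans (≤-reflexive (reflexive (≡.sym k^-a≡))) k^-a≤0)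

    k^-a≤1 : k^-a ≤ 1#
    k^-a≤1 = *-cancelʳ-≤ 0<Y (begin
      k^-a * Y  ≈⟨ k^-a*Y ⟩
      1#        ≤⟨ 1≤power≥1 1≤k 0≤a′ a′≤1 ⟩
      Y         ≈⟨ *-identityˡ Y ⟨
      1# * Y    ∎)

    1≤k*k^-a : 1# ≤ k * k^-a
    1≤k*k^-a = begin
      1#        ≈⟨ k^-a*Y ⟨
      k^-a * Y  ≤⟨ *-monoʳ-≤ (<⇒≤ 0<k^-a) (power≥1-≤-base 1≤k 0≤a′ a′≤1) ⟩
      k^-a * k  ≈⟨ *-comm _ _ ⟩
      k * k^-a  ∎

    -- The exponent a = α/(1+α) solves (1 - a)·α = a, i.e. (k·k^-a)^α = 1/k^-a.
    k^-a≤C*x^α : ∀ {x C} → 1# ≤ C → 1# ≤ x * (C * (k * k^-a)) → k^-a ≤ C * x ^ʳ α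
    k^-a≤C*x^α {x} {C} 1≤C 1≤xCkk^-a with baseView x
    ... | base≤0 x≤0 = contradiction
      (≤-trans 1≤xCkk^-a (≤-trans (*-monoˡ-≤ 0≤Ckk^-a x≤0) (≤-reflexive (zeroˡ _)))) 0<1
      where
      0≤Ckk^-a : 0# ≤ C * (k * k^-a)
      0≤Ckk^-a = *-nonNeg (≤-trans 0≤1 1≤C) (≤-trans 0≤1 1≤k*k^-a)
    ... | base≥1 1≤x = begin
      k^-a        ≤⟨ k^-a≤1 ⟩
      1#          ≈⟨ *-identityˡ 1# ⟨
      1# * 1#     ≤⟨ *-mono-≤ 0≤1 0≤1 1≤C (1≤^ʳ 1≤x 0≤α α≤1) ⟩
      C * x ^ʳ α  ∎
    ... | base<1 0<x x<1 = begin
      k^-a        ≤⟨ z*y≤x⇒z≤x/y 0<X (begin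
        k^-a * X        ≤⟨ *-monoʳ-≤ (<⇒≤ 0<k^-a) X≤CY ⟩
        k^-a * (C * Y)  ≈⟨ solve 3 (λ y c z → y :* (c :* z) := (y :* z) :* c) refl k^-a C Y ⟩
        (k^-a * Y) * C  ≈⟨ trans (*-congʳ k^-a*Y) (*-identityˡ C) ⟩
        C               ∎) ⟩
      C / X       ≡⟨ ≡.cong (C *_) (^ʳ-base<1 0<x x<1 0≤α) ⟨
      C * x ^ʳ α  ∎
      where
      0≤C = ≤-trans 0≤1 1≤C
      0≤k = ≤-trans 0≤1 1≤k
      1≤1/x = 1≤x⁻¹ 0<x x<1
      0≤1/x = ≤-trans 0≤1 1≤1/x
      X = power≥1 (x ⁻¹) α
      0<X = 0<power≥1 1≤1/x 0≤α α≤1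
      x⁻¹Y≤Ck : x ⁻¹ * Y ≤ C * k
      x⁻¹Y≤Ck = *-cancelˡ-≤ 0<x (begin
        x * (x ⁻¹ * Y)               ≈⟨ *-assoc x (x ⁻¹) Y ⟨
        (x * x ⁻¹) * Y               ≈⟨ *-congʳ (*-inverseʳ 0<x) ⟩
        1# * Y                       ≤⟨ *-monoˡ-≤ (<⇒≤ 0<Y) 1≤xCkk^-a ⟩
        (x * (C * (k * k^-a))) * Y   ≈⟨ solve 5 (λ x c k y z →
                                          (x :* (c :* (k :* y))) :* z := (x :* (c :* k)) :* (y :* z))
                                          refl x C k k^-a Y ⟩
        (x * (C * k)) * (k^-a * Y)   ≈⟨ trans (*-congˡ k^-a*Y) (*-identityʳ _) ⟩
        x * (C * k)                  ∎)
      -- Fractional exponents are cleared by comparing powers with exponent `suc q` after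
      -- multiplication by Y ^ p. Then (Y/x) ^ p ≤ (C * k) ^ p, and k ^ p ≤ Y ^ (suc q + p) because
      -- p ≤ suc q * α rearranges to p/(suc q + p) ≤ a.
      X≤CY : X ≤ C * Y
      X≤CY = power≥1-≤ 0≤α λ z p q 0≤z p≤qα z^q≤x^-p →
        ^-cancel-≤ q (*-nonNeg 0≤C (<⇒≤ 0<Y)) (*-cancelʳ-≤ (^-positive p 0<Y) (begin
          z ^ suc q * Y ^ p               ≤⟨ *-monoˡ-≤ (^-nonNeg p (<⇒≤ 0<Y)) z^q≤x^-p ⟩
          (x ⁻¹) ^ p * Y ^ p              ≈⟨ ^-distrib-* (x ⁻¹) Y p ⟨
          (x ⁻¹ * Y) ^ p                  ≤⟨ ^-mono-≤ p (*-nonNeg 0≤1/x (<⇒≤ 0<Y)) x⁻¹Y≤Ck ⟩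
          (C * k) ^ p                     ≈⟨ ^-distrib-* C k p ⟩
          C ^ p * k ^ p                   ≤⟨ *-mono-≤ (^-nonNeg p 0≤C) (^-nonNeg p 0≤k)
                                              (^-monoʳ-≤ 1≤C (p≤qy⇒p≤q p (suc q) α≤1 p≤qα))
                                              (power≥1-root p (q ℕ.+ p) 1≤k 0≤a′ a′≤1 (p≤[q+p]a p (suc q) p≤qα)) ⟩
          C ^ suc q * Y ^ (suc q ℕ.+ p)   ≈⟨ *-congˡ (^-homo-* Y (suc q) p) ⟩
          C ^ suc q * (Y ^ suc q * Y ^ p) ≈⟨ *-assoc _ _ _ ⟨
          (C ^ suc q * Y ^ suc q) * Y ^ p ≈⟨ *-congʳ (^-distrib-* C Y (suc q)) ⟨
          (C * Y) ^ suc q * Y ^ p         ∎))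
        where
        p≤[q+p]a : ∀ p q → fromℕ p ≤ fromℕ q * α → fromℕ p ≤ fromℕ (q ℕ.+ p) * - (- a)
        p≤[q+p]a p q p≤qα = begin
          fromℕ p                    ≤⟨ z*y≤x⇒z≤x/y 0<1+α (≤-by-slack p≤qα
            (solve 3 (λ p q a → (q :+ p) :* a :- p :* (:1 :+ a) := q :* a :- p)
              refl (fromℕ p) (fromℕ q) α)) ⟩
          ((fromℕ q + fromℕ p) * α) / (1# + α)  ≈⟨ *-assoc _ _ _ ⟩
          (fromℕ q + fromℕ p) * a    ≈⟨ *-cong (sym (fromℕ-+ q p)) (sym a′≈a) ⟩
          fromℕ (q ℕ.+ p) * - (- a)  ∎

if-elim : ∀ {a p q} {A : Set a} {P : Set p} (Q : A → Set q) {x y : A} (P? : Dec P) →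
          (P → Q x) → (¬ P → Q y) → Q (if does P? then x else y)
if-elim Q (yes p) Qx Qy = Qx p
if-elim Q (no ¬p) Qx Qy = Qy ¬p

sumℕ : ∀ {k} → Vector ℕ k → ℕ
sumℕ = ℕList.sum ∘ toList

sumℕ-mono-≤ : ∀ {k} (m n : Vector ℕ k) → (∀ i → m i ℕ.≤ n i) → sumℕ m ℕ.≤ sumℕ n
sumℕ-mono-≤ {zero}  m n m≤n = z≤n
sumℕ-mono-≤ {suc k} m n m≤n = ℕ.+-mono-≤ (m≤n zero) (sumℕ-mono-≤ _ _ (m≤n ∘ suc))

sumℕ-updateAt-suc : ∀ {k} (n : Vector ℕ k) i → sumℕ (updateAt n i suc) ≡ suc (sumℕ n)
sumℕ-updateAt-suc n zero    = ≡.refl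
sumℕ-updateAt-suc n (suc i) = ≡.trans
  (≡.cong (n zero ℕ.+_) (sumℕ-updateAt-suc (n ∘ suc) i)) (ℕ.+-suc (n zero) _)

updateAt-suc-≤ : ∀ {k} (n h : Vector ℕ k) i → (∀ j → n j ℕ.≤ h j) → n i ℕ.< h i →
                 ∀ j → updateAt n i suc j ℕ.≤ h j
updateAt-suc-≤ n h i n≤h ni<hi j with j Fin.≟ i
... | yes ≡.refl = ℕ.≤-trans (ℕ.≤-reflexive (updateAt-updates i n)) ni<hi
... | no  j≢i    = ℕ.≤-trans (ℕ.≤-reflexive (updateAt-minimal j i n j≢i)) (n≤h j)

-- Extended reals and the maximum over competitors.

module ExtendedReals (R : Reals) where
  open RealOperations R
  open OrderedField R

  open TotalOrder totalOrder± public using () renaming (refl to ≤±-refl; trans to ≤±-trans)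

  [x]≰⊥ : ∀ {x} → ¬ [ x ] ≤± ⊥±
  [x]≰⊥ (AddSupremum.[ () ])

  ≤-maxOthers : ∀ {k} (g : Vector ℝ± k) {i j} → j ≢ i → g j ≤± maxOthers g i
  ≤-maxOthers g {i} {j} j≢i = All.lookup (Extrema.xs≤max totalOrder± ⊥± _)
    (∈-map⁺ g (∈-filter⁺ (λ j → ¬? (j Fin.≟ i)) (∈-allFin j) j≢i))

  maxOthers-< : ∀ {k} (g : Vector ℝ± k) {i x} → (∀ j → j ≢ i → g j <± [ x ]) →
                maxOthers g i <± [ x ]
  maxOthers-< {k} g {i} {x} g<x = Extrema.argmax-all totalOrder± id {P = _<± [ x ]} [x]≰⊥
    (All.map⁺ (All.tabulate λ {j} j∈ →
      g<x j (proj₂ (∈-filter⁻ (λ j → ¬? (j Fin.≟ i)) {xs = allFin k} j∈))))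

-- Tangents and chords of concave rewards.

module ConcaveRewards (R : Reals) {k : ℕ} (I : Bandits.Instance R k) (T : ℕ) where
  open Bandits R
  open OrderedField R
  open ≤-Reasoning
  open Instance I renaming (reward to f)

  f-mono-≤ : ∀ i {s t} → s ℕ.≤ t → f i s ≤ f i t
  f-mono-≤ i s≤t = go (ℕ.≤⇒≤′ s≤t)
    where
    go : ∀ {s t} → s ℕ.≤′ t → f i s ≤ f i t
    go ℕ.≤′-refl       = ≤-refl
    go (ℕ.≤′-step s≤t) = ≤-trans (go s≤t) (monotone i _)

  f-nonNeg : ∀ i t → 0# ≤ f i t
  f-nonNeg i t = ≤-trans (≤-reflexive (sym (reward-zero i))) (f-mono-≤ i z≤n)

  γ-nonNeg : ∀ i t → 0# ≤ γ I T i t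
  γ-nonNeg i t = 0≤y-x (monotone i t)

  γ-antitone : ∀ i {s t} → s ℕ.≤ t → γ I T i t ≤ γ I T i s
  γ-antitone i s≤t = go (ℕ.≤⇒≤′ s≤t)
    where
    go : ∀ {s t} → s ℕ.≤′ t → γ I T i t ≤ γ I T i s
    go ℕ.≤′-refl       = ≤-refl
    go (ℕ.≤′-step s≤t) = ≤-trans (diminishing i _) (go s≤t)

  below-tangent : ∀ i t d → f i (suc t ℕ.+ d) ≤ f i (suc t) + fromℕ d * γ I T i t
  below-tangent i t zero = ≤-reflexive (trans
    (reflexive (≡.cong (f i) (ℕ.+-identityʳ (suc t))))
    (solve 2 (λ x g → x := x :+ :0 :* g) refl (f i (suc t)) (γ I T i t)))
  below-tangent i t (suc d) = begin
    f i (suc t ℕ.+ suc d)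
      ≡⟨ ≡.cong (f i) (ℕ.+-suc (suc t) d) ⟩
    f i (suc (suc t ℕ.+ d))
      ≈⟨ solve 2 (λ x y → y := x :+ (y :- x)) refl (f i (suc t ℕ.+ d)) _ ⟩
    f i (suc t ℕ.+ d) + γ I T i (suc t ℕ.+ d)
      ≤⟨ +-mono-≤ (below-tangent i t d)
           (γ-antitone i (ℕ.≤-trans (ℕ.n≤1+n t) (ℕ.m≤m+n (suc t) d))) ⟩
    (f i (suc t) + fromℕ d * γ I T i t) + γ I T i t
      ≈⟨ solve 3 (λ x d g → (x :+ d :* g) :+ g := x :+ (:1 :+ d) :* g)
           refl (f i (suc t)) (fromℕ d) (γ I T i t) ⟩
    f i (suc t) + fromℕ (suc d) * γ I T i t ∎

  -- Increments decrease, so the latest one is at most the mean of all increments since f(0) = 0.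
  mean-increment-≥γ : ∀ i t → fromℕ (suc t) * γ I T i t ≤ f i (suc t)
  mean-increment-≥γ i zero = ≤-reflexive (trans
    (solve 2 (λ x y → (:1 :+ :0) :* (y :- x) := y :- x) refl (f i 0) (f i 1))
    (trans (+-congˡ (-‿cong (reward-zero i))) (solve 1 (λ y → y :- :0 := y) refl (f i 1))))
  mean-increment-≥γ i (suc t) = begin
    fromℕ (suc (suc t)) * γ I T i (suc t)
      ≈⟨ solve 2 (λ s g → (:1 :+ s) :* g := g :+ s :* g) refl (fromℕ (suc t)) (γ I T i (suc t)) ⟩
    γ I T i (suc t) + fromℕ (suc t) * γ I T i (suc t)
      ≤⟨ +-monoʳ-≤ _ (*-monoʳ-≤ (fromℕ-nonNeg (suc t)) (diminishing i t)) ⟩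
    γ I T i (suc t) + fromℕ (suc t) * γ I T i t
      ≤⟨ +-monoʳ-≤ _ (mean-increment-≥γ i t) ⟩
    γ I T i (suc t) + f i (suc t)
      ≈⟨ solve 2 (λ x y → (y :- x) :+ x := y) refl (f i (suc t)) (f i (suc (suc t))) ⟩
    f i (suc (suc t)) ∎

  -- The tangent at s lies above f(t), and its slope is at most f(s)/s; hence f(t)/t ≤ f(s)/s,
  -- written without division so that s = 0 is included.
  above-chord : ∀ i {s t} → s ℕ.≤ t → fromℕ s * f i t ≤ fromℕ t * f i s
  above-chord i {zero}  {t} _ = begin
    0# * f i t         ≈⟨ zeroˡ _ ⟩
    0#                 ≤⟨ *-nonNeg (fromℕ-nonNeg t) (f-nonNeg i 0) ⟩
    fromℕ t * f i 0    ∎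
  above-chord i {suc s} {t} 1+s≤t = begin
    S * f i t
      ≡⟨ ≡.cong (λ t → S * f i t) (ℕ.m+[n∸m]≡n 1+s≤t) ⟨
    S * f i (suc s ℕ.+ d)
      ≤⟨ *-monoʳ-≤ (fromℕ-nonNeg (suc s)) (below-tangent i s d) ⟩
    S * (F + D * γ I T i s)
      ≈⟨ solve 4 (λ s x d g → s :* (x :+ d :* g) := s :* x :+ d :* (s :* g))
           refl S F D (γ I T i s) ⟩
    S * F + D * (S * γ I T i s)
      ≤⟨ +-monoʳ-≤ _ (*-monoʳ-≤ (fromℕ-nonNeg d) (mean-increment-≥γ i s)) ⟩
    S * F + D * F
      ≈⟨ solve 3 (λ s x d → s :* x :+ d :* x := (s :+ d) :* x) refl S F D ⟩
    (S + D) * F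
      ≈⟨ *-congʳ (fromℕ-+ (suc s) d) ⟨
    fromℕ (suc s ℕ.+ d) * F
      ≡⟨ ≡.cong (λ t → fromℕ t * F) (ℕ.m+[n∸m]≡n 1+s≤t) ⟩
    fromℕ t * F ∎
    where
    d = t ℕ.∸ suc s
    S = fromℕ (suc s)
    D = fromℕ d
    F = f i (suc s)

-- Stage 1: confidence bounds and certification.

module Stage1 (R : Reals) {k : ℕ} (I : Bandits.Instance R k) (T : ℕ) (i⋆ : Fin k)
              (best : Bandits.IsBest R I T i⋆) (ties : ℕ → RealOperations.ArgMax R k)
              (α : RealOperations.ℝ R) (B : ℕ) where
  open Bandits R
  open OrderedField R
  open ExtendedReals R
  open ConcaveRewards R I T
  open ≤-Reasoning
  open Instance I renaming (reward to f)
  open Hybrid I T i⋆ ties α B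

  lower≤fT : ∀ n i → n i ℕ.≤ T → lower n i ≤ f i T
  lower≤fT n i ni≤T with n i
  ... | zero  = f-nonNeg i T
  ... | suc t = f-mono-≤ i ni≤T

  fT≤upper : ∀ n i → n i ℕ.≤ T → [ f i T ] ≤± upper n i
  fT≤upper n i ni≤T with n i
  ... | zero  = AddExtrema._≤⊤± _ _
  ... | suc t = [ begin
    f i T
      ≡⟨ ≡.cong (f i) (ℕ.m+[n∸m]≡n ni≤T) ⟨
    f i (suc t ℕ.+ (T ℕ.∸ suc t))
      ≤⟨ below-tangent i t (T ℕ.∸ suc t) ⟩
    f i (suc t) + fromℕ (T ℕ.∸ suc t) * γ I T i t
      ≈⟨ +-congˡ (*-congʳ (fromℕ-∸ ni≤T)) ⟨
    f i (suc t) + (fromℕ T - fromℕ (suc t)) * γ I T i t ∎ ]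

  -- The width is `△` at the current count, and both factors of `△` shrink with the count. A count
  -- of at least 2 excludes the unpulled arm, whose width is infinite.
  width-≤-△ : ∀ n i {h} → 2 ℕ.≤ h → h ℕ.≤ n i → n i ℕ.≤ T →
              upper n i -ˡ lower n i ≤± [ △ I T i h ]
  width-≤-△ n i {h} 2≤h h≤ni ni≤T with n i
  ... | zero  = contradiction (ℕ.≤-trans 2≤h h≤ni) λ ()
  ... | suc t = [ begin
    (f i (suc t) + (fromℕ T - fromℕ (suc t)) * γ I T i t) - f i (suc t)
      ≈⟨ solve 2 (λ x w → (x :+ w) :- x := w) refl (f i (suc t)) _ ⟩
    (fromℕ T - fromℕ (suc t)) * γ I T i t
      ≤⟨ *-mono-≤ (0≤y-x (fromℕ-mono-≤ ni≤T)) (γ-nonNeg i t)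
           (≤-by-slack (fromℕ-mono-≤ h≤ni)
             (solve 3 (λ T n h → (T :- h) :- (T :- n) := n :- h)
               refl (fromℕ T) (fromℕ (suc t)) (fromℕ h)))
           (γ-antitone i (ℕ.pred-mono-≤ h≤ni)) ⟩
    (fromℕ T - fromℕ h) * γ I T i (pred h) ∎ ]

  committed-is-best : ∀ n i → (∀ j → n j ℕ.≤ T) → maxOthers (upper n) i <± [ lower n i ] → i ≡ i⋆
  committed-is-best n i n≤T commit with i Fin.≟ i⋆
  ... | yes i≡i⋆ = i≡i⋆
  ... | no  i≢i⋆ = contradiction
    (≤±-trans [ ≤-trans (lower≤fT n i (n≤T i)) (best i) ]
      (≤±-trans (fT≤upper n i⋆ (n≤T i⋆)) (≤-maxOthers (upper n) (i≢i⋆ ∘ ≡.sym))))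
    commit

  -- A real lower bound excludes the value -∞ and a finite width excludes +∞, so `U` is a real
  -- number.
  narrow⇒upper-≤ : ∀ {x l e} U → [ x ] ≤± U → U -ˡ l ≤± [ e ] → U ≤± [ l + e ]
  narrow⇒upper-≤ ⊥±    x≤⊥ _ = contradiction x≤⊥ [x]≰⊥
  narrow⇒upper-≤ {l = l} {e} [ u ] _ [ u-l≤e ] = [ ≤-by-slack u-l≤e
    (solve 3 (λ u l e → (l :+ e) :- u := e :- (u :- l)) refl u l e) ]
  narrow⇒upper-≤ ⊤±    _   ()

  -- A general `M` above the rivals permits case analysis: -∞ means that there is no rival, +∞
  -- contradicts the positive gap. For a real m, let e be a third of the gap. Then L⋆ ≥ f⋆(T) - e
  -- and every rival has U ≤ m + e, so an overlap would force the gap below 2e.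
  narrow⇒separated : ∀ n → (∀ j → n j ℕ.≤ T) → ∀ M → (∀ j → j ≢ i⋆ → [ f j T ] ≤± M) →
                     [ 0# ] <± f i⋆ T -ʳ M →
                     (∀ j → upper n j -ˡ lower n j ≤± third (f i⋆ T -ʳ M)) →
                     ∀ j → j ≢ i⋆ → upper n j <± [ lower n i⋆ ]
  narrow⇒separated n n≤T ⊥±    f≤M 0<gap narrow j j≢i⋆ = contradiction (f≤M j j≢i⋆) [x]≰⊥
  narrow⇒separated n n≤T ⊤±    f≤M 0<gap narrow j j≢i⋆ = contradiction (AddExtrema.⊥±≤_ _ _) 0<gap
  narrow⇒separated n n≤T [ m ] f≤M 0<gap narrow j j≢i⋆ L⋆≤Uj =
    -- Three copies of gap ≤ 2e add up to 3 gap ≤ 6e = 2 gap, so the gap would be at most 0.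
    0<gap [ ≤-by-slack (+-mono-≤ (+-mono-≤ gap≤2e gap≤2e) gap≤2e) (trans
      (solve 2 (λ d e → :0 :- d := (e :* :3 :+ e :* :3) :- ((d :+ d) :+ d)
                                   :+ ((d :- e :* :3) :+ (d :- e :* :3)))
        refl (f i⋆ T - m) e)
      (trans (+-congˡ (trans (+-cong gap-3e gap-3e) (+-identityˡ 0#)))
        (solve 2 (λ d e → ((e :* :3 :+ e :* :3) :- ((d :+ d) :+ d)) :+ :0
                        := (((e :+ e) :+ (e :+ e)) :+ (e :+ e)) :- ((d :+ d) :+ d))
          refl (f i⋆ T - m) e))) ]
    where
    :3 : ∀ {n} → _
    :3 {n} = :1 {n} :+ (:1 :+ (:1 :+ :0))
    e = (f i⋆ T - m) / fromℕ 3
    gap-3e : (f i⋆ T - m) - e * fromℕ 3 ≈ 0#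
    gap-3e = trans (+-congˡ (-‿cong (/-*-cancel (fromℕ-positive {3} (s≤s z≤n))))) (-‿inverseʳ _)
    upper≤ : ∀ j → upper n j ≤± [ lower n j + e ]
    upper≤ j = narrow⇒upper-≤ (upper n j) (fT≤upper n j (n≤T j)) (narrow j)
    f⋆≤L⋆+e : f i⋆ T ≤ lower n i⋆ + e
    f⋆≤L⋆+e = AddExtrema.[≤]-injective _ (≤±-trans (fT≤upper n i⋆ (n≤T i⋆)) (upper≤ i⋆))
    L⋆≤m+e : lower n i⋆ ≤ m + e
    L⋆≤m+e = begin
      lower n i⋆     ≤⟨ AddExtrema.[≤]-injective _ (≤±-trans L⋆≤Uj (upper≤ j)) ⟩
      lower n j + e  ≤⟨ +-mono-≤ (≤-trans (lower≤fT n j (n≤T j))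
                          (AddExtrema.[≤]-injective _ (f≤M j j≢i⋆))) ≤-refl ⟩
      m + e          ∎
    gap≤2e : f i⋆ T - m ≤ e + e
    gap≤2e = ≤-by-slack (+-mono-≤ f⋆≤L⋆+e L⋆≤m+e)
      (solve 4 (λ f l m e → (e :+ e) :- (f :- m) := ((l :+ e) :+ (m :+ e)) :- (f :+ l))
        refl (f i⋆ T) (lower n i⋆) m e)

  -- However ties are broken, the arm with the largest lower bound is i⋆: a rival î would have L⋆ ≤
  -- L(î) ≤ f(T) ≤ U(î) with f its reward, against separation.
  separated⇒commits : ∀ n t → (∀ j → n j ℕ.≤ T) →
                      (∀ j → j ≢ i⋆ → upper n j <± [ lower n i⋆ ]) →
                      let î = proj₁ (ties t λ i → [ lower n i ]) in
                      maxOthers (upper n) î <± [ lower n î ]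
  separated⇒commits n t n≤T separated =
    ≡.subst (λ i → maxOthers (upper n) i <± [ lower n i ]) (≡.sym î≡i⋆)
      (maxOthers-< (upper n) separated)
    where
    î = proj₁ (ties t λ i → [ lower n i ])
    î≡i⋆ : î ≡ i⋆
    î≡i⋆ with î Fin.≟ i⋆
    ... | yes î≡i⋆ = î≡i⋆
    ... | no  î≢i⋆ = contradiction
      (≤±-trans (proj₂ (ties t λ i → [ lower n i ]) i⋆)
        (≤±-trans [ lower≤fT n î (n≤T î) ] (fT≤upper n î (n≤T î))))
      (separated î î≢i⋆)

  module _ (0<gap : [ 0# ] <± gap I T i⋆) (h : Fin k → ℕ)
           (clearing : ∀ i → IsClearingTime I T i (third (gap I T i⋆)) (h i)) where

    h≤T : ∀ i → h i ℕ.≤ T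
    h≤T i = proj₁ (proj₂ (proj₁ (clearing i)))

    -- Every pull goes to an arm that is not yet cleared, so the clearing times
    -- bound the pull counts until the loop commits.
    loop-commits : ∀ b t n → (∀ i → n i ℕ.≤ h i) → sumℕ h ℕ.< sumℕ n ℕ.+ b →
                   loop b t n ≡ inj₁ i⋆
    -- The commitment test runs only while budget is left, so after Σ h pulls one more unit is
    -- required to reach it. This is the source of the strict inequality.
    loop-commits zero    t n n≤h h<n = contradiction (sumℕ-mono-≤ n h n≤h)
      (ℕ.<⇒≱ (ℕ.≤-trans h<n (ℕ.≤-reflexive (ℕ.+-identityʳ (sumℕ n)))))
    loop-commits (suc b) t n n≤h h<n = if-elim (_≡ inj₁ i⋆)
      (maxOthers (upper n) î <±? [ lower n î ])
      (λ commit → ≡.cong inj₁ (committed-is-best n î n≤T commit))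
      (λ undecided → loop-commits b (suc t) (updateAt n i suc)
        (updateAt-suc-≤ n h i n≤h (ℕ.≰⇒> (undecided ∘ separated⇒commits n t n≤T ∘ cleared⇒separated)))
        (ℕ.≤-trans h<n (ℕ.≤-reflexive (≡.trans (ℕ.+-suc (sumℕ n) b)
          (≡.cong (ℕ._+ b) (≡.sym (sumℕ-updateAt-suc n i)))))))
      where
      î = proj₁ (ties t λ i → [ lower n i ])
      i = proj₁ (ties t λ i → upper n i -ˡ lower n i)
      n≤T : ∀ j → n j ℕ.≤ T
      n≤T j = ℕ.≤-trans (n≤h j) (h≤T j)
      cleared⇒separated : h i ℕ.≤ n i → ∀ j → j ≢ i⋆ → upper n j <± [ lower n i⋆ ]
      cleared⇒separated hi≤ni with (2≤hi , _ , △≤ε) , _ ← clearing i =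
        narrow⇒separated n n≤T _ (λ j → ≤-maxOthers (λ j → [ f j T ])) 0<gap
          (λ j → ≤±-trans (proj₂ (ties t λ i → upper n i -ˡ lower n i) j)
            (≤±-trans (width-≤-△ n i 2≤hi hi≤ni (n≤T i)) △≤ε))

  stage1-commits : ∀ θ → GapClearance I T i⋆ θ → θ ℕ.< B → stage1 ≡ inj₁ i⋆
  stage1-commits θ (0<gap , h , clearing , sumℕ-h≤θ) θ<B =
    loop-commits 0<gap h clearing B 0 (const 0) (λ _ → z≤n)
      (ℕ.≤-trans (s≤s sumℕ-h≤θ) (ℕ.≤-trans θ<B (ℕ.m≤n+m B _)))

  -- No arm is pulled more often than all arms together. In Stage 2 this keeps the shifted times
  -- `n i + s` within the horizon.
  loop-counts-≤ : ∀ b t n m → (∀ i → n i ℕ.≤ t) → loop b t n ≡ inj₂ m → ∀ i → m i ℕ.≤ t ℕ.+ b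
  loop-counts-≤ zero    t n m n≤t ≡.refl i = ℕ.≤-trans (n≤t i) (ℕ.m≤m+n t 0)
  loop-counts-≤ (suc b) t n m n≤t = if-elim (λ r → r ≡ inj₂ m → ∀ i → m i ℕ.≤ t ℕ.+ suc b)
    (maxOthers (upper n) î <±? [ lower n î ]) (λ _ ())
    (λ _ eq i → ℕ.≤-trans
      (loop-counts-≤ b (suc t) _ m
        (updateAt-suc-≤ n (const (suc t)) _ (ℕ.m≤n⇒m≤1+n ∘ n≤t) (s≤s (n≤t _))) eq i)
      (ℕ.≤-reflexive (≡.sym (ℕ.+-suc t b))))
    where î = proj₁ (ties t λ i → [ lower n i ])

  stage1-counts-≤ : ∀ n → stage1 ≡ inj₂ n → ∀ i → n i ℕ.≤ B
  stage1-counts-≤ n = loop-counts-≤ B 0 (const 0) n (λ _ → z≤n)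

-- Drawing without replacement.

lookup-removeAt : ∀ {a} {A : Set a} {n} (xs : Vec A (suc n)) i j →
                  lookup (removeAt xs i) j ≡ lookup xs (punchIn i j)
lookup-removeAt xs i j = ≡.trans
  (≡.cong (lookup (removeAt xs i)) (≡.sym (Fin.punchOut-punchIn i)))
  (Vec.removeAt-punchOut xs (Fin.punchInᵢ≢i i j ∘ ≡.sym))

Distinct : ∀ {a} {A : Set a} {n} → Vec A n → Set a
Distinct xs = ∀ {i j} → lookup xs i ≡ lookup xs j → i ≡ j

Avoids : ∀ {a} {A : Set a} {n} → Vec A n → A → Set a
Avoids xs x = ∀ j → lookup xs j ≢ x

module _ {a} {A : Set a} {n} (xs : Vec A (suc n)) (i : Fin (suc n)) where

  removeAt-distinct : Distinct xs → Distinct (removeAt xs i)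
  removeAt-distinct distinct {j} {l} eq = Fin.punchIn-injective i j l
    (distinct (≡.trans (≡.sym (lookup-removeAt xs i j)) (≡.trans eq (lookup-removeAt xs i l))))

  removeAt-avoids : ∀ {x} → Avoids xs x → Avoids (removeAt xs i) x
  removeAt-avoids avoids j eq = avoids _ (≡.trans (≡.sym (lookup-removeAt xs i j)) eq)

  removeAt-avoids-removed : Distinct xs → Avoids (removeAt xs i) (lookup xs i)
  removeAt-avoids-removed distinct j eq =
    Fin.punchInᵢ≢i i j (distinct (≡.trans (≡.sym (lookup-removeAt xs i j)) eq))

-- Expectations of finite random computations.

module Expectation (R : Reals) where
  open RealOperations R
  open OrderedField R
  open ≤-Reasoning
  open Sum (CommutativeRing.+-commutativeMonoid commutativeRing) using (sum-remove)

  sum-≥ : ∀ {r} (x : Vector ℝ r) {z} → (∀ j → z ≤ x j) → fromℕ r * z ≤ sum x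
  sum-≥ {zero}  x {z} z≤x = ≤-reflexive (zeroˡ z)
  sum-≥ {suc r} x {z} z≤x = begin
    (1# + fromℕ r) * z        ≈⟨ solve 2 (λ r z → (:1 :+ r) :* z := z :+ r :* z) refl (fromℕ r) z ⟩
    z + fromℕ r * z           ≤⟨ +-mono-≤ (z≤x zero) (sum-≥ (x ∘ suc) (z≤x ∘ suc)) ⟩
    x zero + sum (x ∘ suc)    ∎

  sum-≥-distinguished : ∀ {r} (x : Vector ℝ (suc r)) a {y z} → y ≤ x a →
                        (∀ j → j ≢ a → z ≤ x j) → y + fromℕ r * z ≤ sum x
  sum-≥-distinguished {r} x a {y} {z} y≤xa z≤x = begin
    y + fromℕ r * z               ≤⟨ +-mono-≤ y≤xa (sum-≥ (x ∘ punchIn a) (λ j → z≤x _ (Fin.punchInᵢ≢i a j))) ⟩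
    x a + sum (x ∘ punchIn a)     ≈⟨ sum-remove {i = a} x ⟨
    sum x                         ∎

  -- This is the recursion for finding `a` within p + 1 draws from r + 1 arms: the draw of `a` is
  -- worth y, and the r other draws, worth p y / r each, add up to p y. When r = 0 the quotient is
  -- unspecified, but then `p ≤ r` forces p = 0.
  mean-≥ : ∀ {p r} (x : Vector ℝ (suc r)) a {y} → p ℕ.≤ r → y ≤ x a →
           (∀ j → j ≢ a → fromℕ p * y ≤ fromℕ r * x j) → fromℕ (suc p) * y ≤ sum x
  mean-≥ {p} {r} x a {y} p≤r y≤xa py≤rx = begin
    (1# + fromℕ p) * y   ≈⟨ solve 2 (λ p y → (:1 :+ p) :* y := y :+ p :* y) refl (fromℕ p) y ⟩
    y + fromℕ p * y      ≤⟨ +-monoʳ-≤ y (py≤r[py/r] p≤r) ⟩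
    y + fromℕ r * z      ≤⟨ sum-≥-distinguished x a y≤xa z≤x ⟩
    sum x                ∎
    where
    z = (fromℕ p * y) / fromℕ r
    py≤r[py/r] : ∀ {p r} → p ℕ.≤ r → fromℕ p * y ≤ fromℕ r * ((fromℕ p * y) / fromℕ r)
    py≤r[py/r] {r = zero}  z≤n = ≤-reflexive (trans (zeroˡ y) (sym (zeroˡ _)))
    py≤r[py/r] {r = suc r} _   = ≤-reflexive (trans
      (sym (/-*-cancel (fromℕ-positive {suc r} (s≤s z≤n)))) (*-comm _ _))
    1≤r : ∀ {r} {j a : Fin (suc r)} → j ≢ a → 1 ℕ.≤ r
    1≤r {zero}  {zero} {zero} j≢a = contradiction ≡.refl j≢a
    1≤r {suc r} _ = s≤s z≤n
    z≤x : ∀ j → j ≢ a → z ≤ x j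
    z≤x j j≢a = x≤z*y⇒x/y≤z (fromℕ-positive (1≤r j≢a))
      (≤-trans (py≤rx j j≢a) (≤-reflexive (*-comm _ _)))

  𝔼-≥ : ∀ {A} (p : Random A) (X : A → ℝ) {z} → (∀ a → z ≤ X a) → z ≤ 𝔼 p X
  𝔼-uniform-≥ : ∀ {A} r (p : Fin (suc r) → Random A) (X : A → ℝ) {z} →
                (∀ j → z ≤ 𝔼 (p j) X) → z ≤ 𝔼 (uniform r p) X
  𝔼-≥ (return a)    X z≤X = z≤X a
  𝔼-≥ (uniform r p) X z≤X = 𝔼-uniform-≥ r p X (λ j → 𝔼-≥ (p j) X z≤X)
  𝔼-uniform-≥ r p X z≤p = z*y≤x⇒z≤x/y (fromℕ-positive {suc r} (s≤s z≤n))
    (≤-trans (≤-reflexive (*-comm _ _)) (sum-≥ (λ j → 𝔼 (p j) X) z≤p))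

-- From the envelope exponent to LE(α).

module Envelope (R : Reals) {k : ℕ} (I : Bandits.Instance R k) (T : ℕ) (1≤T : 1 ℕ.≤ T) where
  open Bandits R
  open OrderedField R
  open RealPowers R
  open ConcaveRewards R I T
  open ≤-Reasoning
  open Instance I renaming (reward to f)

  0<T : 0# < fromℕ T
  0<T = fromℕ-positive 1≤T

  t/T≤1 : ∀ {t} → t ℕ.≤ T → fromℕ t / fromℕ T ≤ 1#
  t/T≤1 t≤T = x≤z*y⇒x/y≤z 0<T
    (≤-trans (fromℕ-mono-≤ t≤T) (≤-reflexive (sym (*-identityˡ _))))

  LE-mono : ∀ {β β′ i} → 0# < β → β ≤ β′ → β′ ≤ 1# → LE I T β i → LE I T β′ i
  LE-mono {i = i} 0<β β≤β′ β′≤1 le t t≤T = ≤-trans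
    (*-monoʳ-≤ (f-nonNeg i T) (^ʳ-antitone (t/T≤1 t≤T) 0<β β≤β′ β′≤1)) (le t t≤T)

  -- A concave reward lies above its chord from 0 to T. This puts 1 into the set whose infimum is
  -- the envelope exponent, so that the infimum is meaningful.
  LE-1 : ∀ i → LE I T 1# i
  LE-1 i t t≤T = begin
    f i T * (fromℕ t / fromℕ T) ^ʳ 1#
      ≤⟨ *-monoʳ-≤ (f-nonNeg i T) (^ʳ-1 (0≤x/y (fromℕ-nonNeg t) 0<T) (t/T≤1 t≤T)) ⟩
    f i T * (fromℕ t / fromℕ T)
      ≈⟨ solve 3 (λ x t s → x :* (t :* s) := (t :* x) :* s) refl (f i T) (fromℕ t) (fromℕ T ⁻¹) ⟩
    (fromℕ t * f i T) / fromℕ T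
      ≤⟨ x≤z*y⇒x/y≤z 0<T (≤-trans (above-chord i t≤T) (≤-reflexive (*-comm _ _))) ⟩
    f i t ∎

  -- LE is inherited by larger exponents up to 1. If it failed at α, no admissible exponent could
  -- lie below α, and their infimum would be at least α.
  LE-above-exponent : ∀ {α} → envelopeExponent I T < α → α ≤ 1# → ∀ i → LE I T α i
  LE-above-exponent {α} β<α α≤1 i t t≤T with f i T * (fromℕ t / fromℕ T) ^ʳ α ≤? f i t
  ... | yes le = le
  ... | no ¬le = contradiction (≤-by-slack (sup-least _ (- 1# , inhabited) (- α) bound)
      (solve 2 (λ a s → :- s :- a := :- a :- s) refl α _)) β<α
    where
    1≈--1 : 1# ≈ - (- 1#)
    1≈--1 = solve 0 (:1 := :- (:- :1)) refl
    inhabited : 0# < - (- 1#) × - (- 1#) ≤ 1# × (∀ i → LE I T (- (- 1#)) i)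
    inhabited = <-≤-trans 0<1 (≤-reflexive 1≈--1) , ≤-reflexive (sym 1≈--1) ,
      λ i → LE-mono 0<1 (≤-reflexive 1≈--1) (≤-reflexive (sym 1≈--1)) (LE-1 i)
    bound : ∀ x → 0# < - x × - x ≤ 1# × (∀ i → LE I T (- x) i) → x ≤ - α
    bound x (0<-x , -x≤1 , le) with α ≤? - x
    ... | yes α≤-x = ≤-by-slack α≤-x (solve 2 (λ x a → :- a :- x := :- x :- a) refl x α)
    ... | no  -x<α = contradiction (LE-mono 0<-x (<⇒≤ -x<α) α≤1 (le i) t t≤T) ¬le

-- PTRR: cost of the draws and expected value.

module RoundRobin (R : Reals) {k : ℕ} (argmax : RealOperations.ArgMax R k)
                  (α m τ : RealOperations.ℝ R) (g : Fin k → ℕ → RealOperations.ℝ R) where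
  open Bandits R
  open OrderedField R
  open ExtendedReals R
  open Expectation R
  open ≤-Reasoning
  open PTRR argmax α m τ g

  Passes : Fin k → ℕ → Set
  Passes i s = m * (fromℕ s / τ) ^ʳ α ≤ g i s

  private
    passes? : ∀ i s → Dec (Passes i s)
    passes? i s = m * (fromℕ s / τ) ^ʳ α ≤? g i s

  play-conserves : ∀ i s n → proj₁ (play i s n) ℕ.+ proj₂ (play i s n) ≡ s ℕ.+ n
  play-conserves i s zero    = ≡.refl
  play-conserves i s (suc n) = if-elim (λ p → proj₁ p ℕ.+ proj₂ p ≡ s ℕ.+ suc n) (passes? i s)
    (λ _ → ≡.trans (play-conserves i (suc s) n) (≡.sym (ℕ.+-suc s n)))
    (λ _ → ≡.refl)

  play-≤ : ∀ i n → proj₁ (play i 0 n) ℕ.≤ n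
  play-≤ i n = ℕ.≤-trans (ℕ.m≤m+n _ _) (ℕ.≤-reflexive (play-conserves i 0 n))

  play-rest-≤ : ∀ i n → proj₂ (play i 0 n) ℕ.≤ n
  play-rest-≤ i n = ℕ.≤-trans (ℕ.m≤n+m _ _) (ℕ.≤-reflexive (play-conserves i 0 n))

  play-all : ∀ i s n → (∀ s′ → s′ ℕ.< s ℕ.+ n → Passes i s′) → proj₁ (play i s n) ≡ s ℕ.+ n
  play-all i s zero    passes = ≡.sym (ℕ.+-identityʳ s)
  play-all i s (suc n) passes = if-elim (λ p → proj₁ p ≡ s ℕ.+ suc n) (passes? i s)
    (λ _ → ≡.trans
      (play-all i (suc s) n λ s′ s′< → passes s′ (ℕ.≤-trans s′< (ℕ.≤-reflexive (≡.sym (ℕ.+-suc s n)))))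
      (≡.sym (ℕ.+-suc s n)))
    (λ fails → contradiction (passes s (ℕ.m<m+n s (s≤s z≤n))) fails)

  PassesBefore : Fin k → ℕ → Set
  PassesBefore i s = ∃ λ s⁻ → s ≡ suc s⁻ × Passes i s⁻

  -- Every pull follows a passed test, also when the arm is left only because the pulls ran out.
  play-passes-before : ∀ i s n → Passes i s → PassesBefore i (proj₁ (play i (suc s) n))
  play-passes-before i s zero    passes = s , ≡.refl , passes
  play-passes-before i s (suc n) passes =
    if-elim (PassesBefore i ∘ proj₁) (passes? i (suc s))
      (play-passes-before i (suc s) n) (λ _ → s , ≡.refl , passes)

  played-passes-before : ∀ i n → Passes i 0 → PassesBefore i (proj₁ (play i 0 (suc n)))
  played-passes-before i n passes₀ = if-elim (PassesBefore i ∘ proj₁) (passes? i 0)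
    (play-passes-before i 0 n) (λ fails → contradiction passes₀ fails)

  after-drawing : ∀ {r} → Vec (Fin k) (suc r) → ℕ → Vector ℝ± k → Fin (suc r) → Random (Fin k)
  after-drawing unused n v j = run (removeAt unused j) (proj₂ (play i 0 n))
                                   (updateAt v i (const [ g i (proj₁ (play i 0 n)) ]))
    where i = lookup unused j

  module _ (X : Fin k → ℝ) (N : ℕ) (g≤X : ∀ i s → s ℕ.≤ N → g i s ≤ X i) where

    Recorded : Vector ℝ± k → Set
    Recorded v = ∀ i → v i ≤± [ X i ]

    updateAt-recorded : ∀ v i {s} → s ℕ.≤ N → Recorded v →
                        Recorded (updateAt v i (const [ g i s ]))
    updateAt-recorded v i s≤N v≤X j with j Fin.≟ i
    ... | yes ≡.refl = ≡.subst (_≤± [ X i ]) (≡.sym (updateAt-updates i v)) [ g≤X i _ s≤N ]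
    ... | no  j≢i    = ≡.subst (_≤± [ X j ]) (≡.sym (updateAt-minimal j i v j≢i)) (v≤X j)

    -- The returned arm need not be `i`, but its record is at least as large, and `X` dominates
    -- records. This turns an observed value into a bound on the final value of the arm returned.
    argmax-≥ : ∀ {v z} → Recorded v → ∀ i → [ z ] ≤± v i → z ≤ X (proj₁ (argmax v))
    argmax-≥ {v} v≤X i z≤vi = AddExtrema.[≤]-injective _
      (≤±-trans z≤vi (≤±-trans (proj₂ (argmax v) i) (v≤X _)))

    -- An arm that is no longer available cannot be drawn again, so its record is never overwritten.
    𝔼-run-≥-recorded : ∀ {r} (unused : Vec (Fin k) r) n v {z} i → n ℕ.≤ N → Recorded v →
                       Avoids unused i → [ z ] ≤± v i → z ≤ 𝔼 (run unused n v) X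
    𝔼-run-≥-recorded {zero}  unused n       v i n≤N v≤X avoids z≤vi = argmax-≥ v≤X i z≤vi
    𝔼-run-≥-recorded {suc r} unused zero    v i n≤N v≤X avoids z≤vi = argmax-≥ v≤X i z≤vi
    𝔼-run-≥-recorded {suc r} unused (suc n) v {z} i n≤N v≤X avoids z≤vi =
      𝔼-uniform-≥ r (after-drawing unused (suc n) v) X λ j → let l = lookup unused j in
        𝔼-run-≥-recorded (removeAt unused j) _ _ i
          (ℕ.≤-trans (play-rest-≤ l (suc n)) n≤N)
          (updateAt-recorded v l (ℕ.≤-trans (play-≤ l (suc n)) n≤N) v≤X)
          (removeAt-avoids unused j avoids)
          (≡.subst ([ z ] ≤±_) (≡.sym (updateAt-minimal i l v (avoids j ∘ ≡.sym))) z≤vi)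

    -- q₀ is the number of draws within which i⋆ is hoped for.  An arm left after
    -- s + 1 pulls with 2·q₀·s ≥ τ has reached M; the others waste so few pulls
    -- that half of the horizon is left for i⋆, which then reaches G.
    module _ (i⋆ : Fin k) (τᴺ q₀ : ℕ) (G M : ℝ) (M≤G : M ≤ G)
             (0≤X : ∀ i → 0# ≤ X i)
             (passes₀ : ∀ i → Passes i 0)
             (long : ∀ n → n ℕ.≤ N → τᴺ ℕ.≤ 2 ℕ.* n → G ≤ g i⋆ (proj₁ (play i⋆ 0 n)))
             (large : ∀ i s → τᴺ ℕ.≤ q₀ ℕ.* (2 ℕ.* s) → Passes i s → M ≤ g i (suc s)) where

      -- Each of the `used` arms has cost one pull, and `waste` counts the remaining pulls spent on
      -- them. The last field says that a recorded `M` is worth at least the chance q/r of still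
      -- drawing i⋆ and gaining `G`.
      record Invariant (q r n used waste : ℕ) : Set where
        field
          draws     : used ℕ.+ q ≡ q₀
          arms      : used ℕ.+ r ≡ k
          budget    : n ℕ.+ (used ℕ.+ waste) ≡ τᴺ ℕ.+ k
          waste-≤   : q₀ ℕ.* (2 ℕ.* waste) ℕ.≤ used ℕ.* τᴺ
          q≤r       : q ℕ.≤ r
          q*G≤r*M   : fromℕ q * G ≤ fromℕ r * M

      -- Since `used ≤ q₀`, the waste is at most half of `τᴺ`. Since an arm is left, `used < k`, so
      -- the k extra pulls of the budget are not exhausted either.
      τ<2n : ∀ {q r n used waste} → Invariant (suc q) (suc r) n used waste → τᴺ ℕ.< 2 ℕ.* n
      τ<2n {q} {r} {n} {used} {waste} inv = ℕ.≰⇒> λ 2n≤τ →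
        ℕ.<⇒≱ used<k (k≤used 2n≤τ)
        where
        open Invariant inv
        used<k : used ℕ.< k
        used<k = ℕ.≤-trans (ℕ.m<m+n used (s≤s z≤n)) (ℕ.≤-reflexive arms)
        used≤q₀ : used ℕ.≤ q₀
        used≤q₀ = ℕ.≤-trans (ℕ.m≤m+n used (suc q)) (ℕ.≤-reflexive draws)
        0<q₀ : 0 ℕ.< q₀
        0<q₀ = ℕ.≤-trans (ℕ.≤-trans (s≤s z≤n) (ℕ.m≤n+m (suc q) used)) (ℕ.≤-reflexive draws)
        2waste≤τ : 2 ℕ.* waste ℕ.≤ τᴺ
        2waste≤τ = ℕ.*-cancelˡ-≤ q₀ {{ℕ.>-nonZero 0<q₀}}
          (ℕ.≤-trans waste-≤ (ℕ.*-monoˡ-≤ τᴺ used≤q₀))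
        k≤used : 2 ℕ.* n ℕ.≤ τᴺ → k ℕ.≤ used
        k≤used 2n≤τ = ℕ.+-cancelˡ-≤ τᴺ k used (ℕ.≤-trans (ℕ.≤-reflexive (≡.trans (≡.sym budget)
            (+-*-Solver.solve 3 (λ n u w → n :⊕ (u :⊕ w) :⊜ (n :⊕ w) :⊕ u) ≡.refl n used waste)))
          (ℕ.+-monoˡ-≤ used (ℕ.*-cancelˡ-≤ 2 (ℕ.≤-trans
            (ℕ.≤-reflexive (ℕ.*-distribˡ-+ 2 n waste))
            (ℕ.≤-trans (ℕ.+-mono-≤ 2n≤τ 2waste≤τ)
              (ℕ.≤-reflexive (≡.cong (τᴺ ℕ.+_) (≡.sym (ℕ.+-identityʳ τᴺ)))))))))
          where open +-*-Solver renaming (_:=_ to _:⊜_; _:+_ to _:⊕_)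

      next : ∀ {q r n used waste s n′} → Invariant (suc q) (suc r) (suc n) used waste →
             suc s ℕ.+ n′ ≡ suc n → q₀ ℕ.* (2 ℕ.* s) ℕ.≤ τᴺ →
             fromℕ q * G ≤ fromℕ r * M →
             Invariant q r n′ (suc used) (waste ℕ.+ s)
      next {q} {r} {n} {used} {waste} {s} {n′} inv eq few qG≤rM = record
        { draws   = ≡.trans (≡.sym (ℕ.+-suc used q)) draws
        ; arms    = ≡.trans (≡.sym (ℕ.+-suc used r)) arms
        ; budget  = ≡.trans
            (+-*-Solver.solve 4 (λ n′ u w s →
                n′ :⊕ (+-*-Solver.con 1 :⊕ u :⊕ (w :⊕ s)) :⊜ ((+-*-Solver.con 1 :⊕ s) :⊕ n′) :⊕ (u :⊕ w))
              ≡.refl n′ used waste s)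
            (≡.trans (≡.cong (ℕ._+ (used ℕ.+ waste)) eq) budget)
        ; waste-≤ = ℕ.≤-trans
            (ℕ.≤-reflexive (+-*-Solver.solve 3 (λ q w s →
                q :⊗ (+-*-Solver.con 2 :⊗ (w :⊕ s)) :⊜ q :⊗ (+-*-Solver.con 2 :⊗ s) :⊕ q :⊗ (+-*-Solver.con 2 :⊗ w))
              ≡.refl q₀ waste s))
            (ℕ.+-mono-≤ few waste-≤)
        ; q≤r     = ℕ.s≤s⁻¹ q≤r
        ; q*G≤r*M = qG≤rM
        }
        where
        open Invariant inv
        open +-*-Solver renaming (_:=_ to _:⊜_; _:+_ to _:⊕_; _:*_ to _:⊗_)

      -- Induction on the draws hoped for. Drawing i⋆ gains `G`; any other arm either records `M`,
      -- which settles its branch by the last field of the invariant, or wastes little enough for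
      -- the induction to continue.
      q*G≤r*𝔼-run : ∀ q {r} (unused : Vec (Fin k) r) n v {used waste} →
                    Distinct unused → (a : Fin r) → lookup unused a ≡ i⋆ → n ℕ.≤ N → Recorded v →
                    Invariant q r n used waste → fromℕ q * G ≤ fromℕ r * 𝔼 (run unused n v) X
      q*G≤r*𝔼-run zero {r} unused n v distinct a a≡i⋆ n≤N v≤X inv = ≤-trans (≤-reflexive (zeroˡ G))
        (*-nonNeg (fromℕ-nonNeg r) (𝔼-≥ (run unused n v) X 0≤X))
      q*G≤r*𝔼-run (suc q) {suc r} unused zero v distinct a a≡i⋆ n≤N v≤X inv =
        contradiction (τ<2n inv) λ ()
      q*G≤r*𝔼-run (suc q) {suc r} unused (suc n) v {used} {waste} distinct a a≡i⋆ n≤N v≤X inv = begin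
        fromℕ (suc q) * G
          ≤⟨ mean-≥ branch a (ℕ.s≤s⁻¹ q≤r) star others ⟩
        sum branch
          ≈⟨ /-*-cancel (fromℕ-positive {suc r} (s≤s z≤n)) ⟨
        (sum branch / fromℕ (suc r)) * fromℕ (suc r)
          ≈⟨ *-comm _ _ ⟩
        fromℕ (suc r) * 𝔼 (run unused (suc n) v) X ∎
        where
        open Invariant inv
        pulls rest : Fin (suc r) → ℕ
        pulls j = proj₁ (play (lookup unused j) 0 (suc n))
        rest  j = proj₂ (play (lookup unused j) 0 (suc n))
        v′ : Fin (suc r) → Vector ℝ± k
        v′ j = updateAt v (lookup unused j) (const [ g (lookup unused j) (pulls j) ])
        branch : Fin (suc r) → ℝ
        branch j = 𝔼 (after-drawing unused (suc n) v j) X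
        v′≤X : ∀ j → Recorded (v′ j)
        v′≤X j = updateAt-recorded v (lookup unused j)
          (ℕ.≤-trans (play-≤ (lookup unused j) (suc n)) n≤N) v≤X
        rest≤N : ∀ j → rest j ℕ.≤ N
        rest≤N j = ℕ.≤-trans (play-rest-≤ (lookup unused j) (suc n)) n≤N
        reached : ∀ j {z} → z ≤ g (lookup unused j) (pulls j) → z ≤ branch j
        reached j {z} z≤g = 𝔼-run-≥-recorded (removeAt unused j) (rest j) (v′ j) (lookup unused j)
          (rest≤N j) (v′≤X j) (removeAt-avoids-removed unused j distinct)
          (≡.subst ([ z ] ≤±_) (≡.sym (updateAt-updates (lookup unused j) v)) [ z≤g ])
        star : G ≤ branch a
        star = reached a (≡.subst (λ i → G ≤ g i (proj₁ (play i 0 (suc n)))) (≡.sym a≡i⋆)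
          (long (suc n) n≤N (ℕ.<⇒≤ (τ<2n inv))))
        -- One draw fewer removes `G` on the left but only `M`, which is no larger, on the right.
        qG≤rM : fromℕ q * G ≤ fromℕ r * M
        qG≤rM = ≤-by-slack (+-mono-≤ q*G≤r*M M≤G)
          (solve 4 (λ q r G M → r :* M :- q :* G
                             := ((:1 :+ r) :* M :+ G) :- ((:1 :+ q) :* G :+ M))
            refl (fromℕ q) (fromℕ r) G M)
        others : ∀ j → j ≢ a → fromℕ q * G ≤ fromℕ r * branch j
        others j j≢a with s , pulls≡1+s , passes ← played-passes-before (lookup unused j) n (passes₀ _)
                     with τᴺ ℕ.≤? q₀ ℕ.* (2 ℕ.* s)
        ... | yes many = ≤-trans qG≤rM (*-monoʳ-≤ (fromℕ-nonNeg r) (reached j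
          (≡.subst (λ t → M ≤ g (lookup unused j) t) (≡.sym pulls≡1+s)
            (large (lookup unused j) s many passes))))
        ... | no  few  = q*G≤r*𝔼-run q (removeAt unused j) (rest j) (v′ j)
          (removeAt-distinct unused j distinct)
          (punchOut j≢a) (≡.trans (Vec.removeAt-punchOut unused j≢a) a≡i⋆)
          (rest≤N j) (v′≤X j)
          (next inv
            (≡.trans (≡.cong (ℕ._+ rest j) (≡.sym pulls≡1+s)) (play-conserves (lookup unused j) 0 (suc n)))
            (ℕ.<⇒≤ (ℕ.≰⇒> few)) qG≤rM)

-- Stage 2: thresholds, constants and the final bound.

module Stage2 (R : Reals) {k : ℕ} (I : Bandits.Instance R k) (T : ℕ) (1≤T : 1 ℕ.≤ T) (i⋆ : Fin k)
              (ties : ℕ → RealOperations.ArgMax R k)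
              (α : RealOperations.ℝ R) (B : ℕ) (B≤T : B ℕ.≤ T)
              (0<α : RealOperations._<_ R (Reals.0# R) α)
              (α≤1 : Reals._≤_ R α (Reals.1# R))
              (le : Bandits.LE R I T α i⋆)
              (0<τ′ : RealOperations._<_ R (Reals.0# R) (Bandits.Hybrid.τ′ R I T i⋆ ties α B))
              (n : Fin k → ℕ) (n≤B : ∀ i → n i ℕ.≤ B) where
  open Bandits R
  open OrderedField R
  open RealPowers R
  open ConcaveRewards R I T
  open ≤-Reasoning
  open Instance I renaming (reward to f)
  open Hybrid I T i⋆ ties α B

  g : Fin k → ℕ → ℝ
  g i s = f i (n i ℕ.+ s)

  N τ : ℕ
  N = T ℕ.∸ B
  τ = N ℕ.∸ k

  open RoundRobin R (ties B) α m′ τ′ g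

  private
    0<T : 0# < fromℕ T
    0<T = fromℕ-positive 1≤T

    1≤k : 1# ≤ fromℕ k
    1≤k = ≤-trans (≤-reflexive (sym (+-identityʳ 1#))) (fromℕ-mono-≤ (1≤ i⋆))
      where
      1≤ : ∀ {k} → Fin k → 1 ℕ.≤ k
      1≤ {suc k} _ = s≤s z≤n

    0<k = <-≤-trans 0<1 1≤k

    N-k≈τ′ : fromℕ N - fromℕ k ≈ τ′
    N-k≈τ′ = +-congʳ (sym (fromℕ-∸ B≤T))

    k≤N : k ℕ.≤ N
    k≤N = fromℕ-cancel-≤ (≤-by-slack (≤-trans (<⇒≤ 0<τ′) (≤-reflexive (sym N-k≈τ′)))
      (solve 2 (λ N k → N :- k := (N :- k) :- :0) refl (fromℕ N) (fromℕ k)))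

    τ≈τ′ : fromℕ τ ≈ τ′
    τ≈τ′ = trans (sym (fromℕ-∸ k≤N)) N-k≈τ′

    u : ℝ
    u = τ′ / fromℕ T

    0<u : 0# < u
    0<u = *-positive 0<τ′ (⁻¹-positive 0<T)

    u≤1 : u ≤ 1#
    u≤1 = x≤z*y⇒x/y≤z 0<T (begin
      τ′            ≈⟨ τ≈τ′ ⟨
      fromℕ τ       ≤⟨ fromℕ-mono-≤ (ℕ.≤-trans (ℕ.m∸n≤m N k) (ℕ.m∸n≤m T B)) ⟩
      fromℕ T       ≈⟨ *-identityˡ _ ⟨
      1# * fromℕ T  ∎)

    0≤m′ : 0# ≤ m′
    0≤m′ = *-nonNeg (<⇒≤ 0<u) (f-nonNeg i⋆ T)

    m′*T≈τ′*f : m′ * fromℕ T ≈ τ′ * f i⋆ T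
    m′*T≈τ′*f = trans (solve 3 (λ u f t → (u :* f) :* t := (u :* t) :* f) refl u (f i⋆ T) (fromℕ T))
                      (*-congʳ (/-*-cancel 0<T))

  f≤g : ∀ i s → f i s ≤ g i s
  f≤g i s = f-mono-≤ i (ℕ.m≤n+m s (n i))

  g≤fT : ∀ i s → s ℕ.≤ N → g i s ≤ f i T
  g≤fT i s s≤N = f-mono-≤ i (ℕ.≤-trans (ℕ.+-mono-≤ (n≤B i) s≤N) (ℕ.≤-reflexive (ℕ.m+[n∸m]≡n B≤T)))

  passes-0 : ∀ i → Passes i 0
  passes-0 i = begin
    m′ * (0# / τ′) ^ʳ α   ≡⟨ ≡.cong (m′ *_) (^ʳ-base≤0 (≤-reflexive (zeroˡ _)) 0<α) ⟩
    m′ * 0#               ≈⟨ zeroʳ m′ ⟩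
    0#                    ≤⟨ f-nonNeg i _ ⟩
    g i 0                 ∎

  -- With u = τ′/T the test asks for f⋆(T) u (s/τ′)^α. Since u ≤ u^α, this is at most f⋆(T) (s/T)^α,
  -- the bound of LE(α); the pulls of Stage 1 only raise the reward.
  best-passes : ∀ s → s ℕ.≤ T → Passes i⋆ s
  best-passes s s≤T = begin
    m′ * (fromℕ s / τ′) ^ʳ α
      ≈⟨ solve 3 (λ u f x → (u :* f) :* x := f :* (u :* x)) refl u (f i⋆ T) _ ⟩
    f i⋆ T * (u * (fromℕ s / τ′) ^ʳ α)
      ≤⟨ *-monoʳ-≤ (f-nonNeg i⋆ T) (*-^ʳ-≤ 0<u u≤1 s/T≈us/τ′ s/T≤1 0<α α≤1) ⟩
    f i⋆ T * (fromℕ s / fromℕ T) ^ʳ α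
      ≤⟨ le s s≤T ⟩
    f i⋆ s
      ≤⟨ f≤g i⋆ s ⟩
    g i⋆ s ∎
    where
    s/T≈us/τ′ : fromℕ s / fromℕ T ≈ u * (fromℕ s / τ′)
    s/T≈us/τ′ = sym (trans
      (solve 4 (λ t T⁻¹ s t⁻¹ → (t :* T⁻¹) :* (s :* t⁻¹) := (t :* t⁻¹) :* (s :* T⁻¹))
        refl τ′ (fromℕ T ⁻¹) (fromℕ s) (τ′ ⁻¹))
      (trans (*-congʳ (*-inverseʳ 0<τ′)) (*-identityˡ _)))
    s/T≤1 : fromℕ s / fromℕ T ≤ 1#
    s/T≤1 = Envelope.t/T≤1 R I T 1≤T s≤T

  -- The chord to T has height at least τ′/(2T) f⋆(T) at s, which is m′/2.
  half-horizon : ∀ s → s ℕ.≤ T → τ ℕ.≤ 2 ℕ.* s → m′ ≤ fromℕ 2 * f i⋆ s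
  half-horizon s s≤T τ≤2s = *-cancelʳ-≤ 0<T (begin
    m′ * fromℕ T                  ≈⟨ m′*T≈τ′*f ⟩
    τ′ * f i⋆ T                   ≈⟨ *-congʳ τ≈τ′ ⟨
    fromℕ τ * f i⋆ T              ≤⟨ *-monoˡ-≤ (f-nonNeg i⋆ T) (fromℕ-mono-≤ τ≤2s) ⟩
    fromℕ (2 ℕ.* s) * f i⋆ T      ≈⟨ *-congʳ (fromℕ-* 2 s) ⟩
    (fromℕ 2 * fromℕ s) * f i⋆ T  ≈⟨ *-assoc _ _ _ ⟩
    fromℕ 2 * (fromℕ s * f i⋆ T)  ≤⟨ *-monoʳ-≤ (fromℕ-nonNeg 2) (above-chord i⋆ s≤T) ⟩
    fromℕ 2 * (fromℕ T * f i⋆ s)  ≈⟨ solve 3 (λ a b c → a :* (b :* c) := (a :* c) :* b)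
                                       refl (fromℕ 2) (fromℕ T) (f i⋆ s) ⟩
    (fromℕ 2 * f i⋆ s) * fromℕ T  ∎)

  open OptimalExponent 1≤k 0<α α≤1

  private
    0<8 = fromℕ-positive {8} (s≤s z≤n)

    -- The arm i⋆ accounts only for a factor 2. The 8 comes from long survivors: rounding up k y
    -- gives M ≤ 2 y G, and τ ≤ 2 q₀ s with q₀ ≤ 2 k y gives s/τ′ ≥ 1/(4 k y), hence y ≤ 4 (s/τ′)^α.
    G : ℝ
    G = m′ / fromℕ 8

    0≤G : 0# ≤ G
    0≤G = 0≤x/y 0≤m′ 0<8

    G*8≈m′ : G * fromℕ 8 ≈ m′
    G*8≈m′ = /-*-cancel 0<8

    ky = fromℕ k * k^-a

    0≤ky : 0# ≤ ky
    0≤ky = ≤-trans 0≤1 1≤k*k^-a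

    ky≤k : ky ≤ fromℕ k
    ky≤k = ≤-trans (*-monoʳ-≤ (<⇒≤ 0<k) k^-a≤1) (≤-reflexive (*-identityʳ _))

    q₀ : ℕ
    q₀ = proj₁ (ceiling 0≤ky k ky≤k)

    q₀≤k : q₀ ℕ.≤ k
    q₀≤k = proj₁ (proj₂ (ceiling 0≤ky k ky≤k))

    ky≤q₀ : ky ≤ fromℕ q₀
    ky≤q₀ = proj₁ (proj₂ (proj₂ (ceiling 0≤ky k ky≤k)))

    q₀≤2ky : fromℕ q₀ ≤ ky + ky
    q₀≤2ky = ≤-trans (proj₂ (proj₂ (proj₂ (ceiling 0≤ky k ky≤k)))) (+-mono-≤ 1≤k*k^-a ≤-refl)

    -- The share of `G` given by the chance q₀/k that i⋆ is among the first q₀ draws.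
    M : ℝ
    M = (fromℕ q₀ * G) / fromℕ k

    M≤G : M ≤ G
    M≤G = x≤z*y⇒x/y≤z 0<k (≤-trans (*-monoˡ-≤ 0≤G (fromℕ-mono-≤ q₀≤k)) (≤-reflexive (*-comm _ _)))

    M≤2yG : M ≤ (k^-a + k^-a) * G
    M≤2yG = x≤z*y⇒x/y≤z 0<k (≤-trans (*-monoˡ-≤ 0≤G q₀≤2ky) (≤-reflexive
      (solve 3 (λ k y G → (k :* y :+ k :* y) :* G := ((y :+ y) :* G) :* k) refl (fromℕ k) k^-a G)))

    :2 :4 :8 : ∀ {n} → _
    :2 {n} = :1 {n} :+ (:1 :+ :0)
    :4 {n} = :1 {n} :+ (:1 :+ :2)
    :8 {n} = :1 {n} :+ (:1 :+ (:1 :+ (:1 :+ :4)))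

  best-reaches-G : ∀ s → s ℕ.≤ N → τ ℕ.≤ 2 ℕ.* s →
                   G ≤ g i⋆ (proj₁ (PTRR.play (ties B) α m′ τ′ g i⋆ 0 s))
  best-reaches-G s s≤N τ≤2s = begin
    G                      ≤⟨ x≤z*y⇒x/y≤z 0<8 (begin
      m′                       ≤⟨ half-horizon s s≤T τ≤2s ⟩
      fromℕ 2 * f i⋆ s         ≤⟨ *-monoˡ-≤ (f-nonNeg i⋆ s) (fromℕ-mono-≤ {2} {8} (s≤s (s≤s z≤n))) ⟩
      fromℕ 8 * f i⋆ s         ≈⟨ *-comm _ _ ⟩
      f i⋆ s * fromℕ 8         ∎) ⟩
    f i⋆ s                 ≤⟨ f≤g i⋆ s ⟩
    g i⋆ s                 ≡⟨ ≡.cong (g i⋆) (play-all i⋆ 0 s λ s′ s′<s →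
                                best-passes s′ (ℕ.≤-trans (ℕ.<⇒≤ s′<s) s≤T)) ⟨
    g i⋆ (proj₁ (PTRR.play (ties B) α m′ τ′ g i⋆ 0 s)) ∎
    where s≤T = ℕ.≤-trans s≤N (ℕ.m∸n≤m T B)

  long-played-reaches-M : ∀ i s → τ ℕ.≤ q₀ ℕ.* (2 ℕ.* s) → Passes i s → M ≤ g i (suc s)
  long-played-reaches-M i s τ≤2q₀s passes = begin
    M                             ≤⟨ M≤2yG ⟩
    (k^-a + k^-a) * G             ≤⟨ *-monoˡ-≤ 0≤G (+-mono-≤ y≤4x^α y≤4x^α) ⟩
    (fromℕ 4 * x ^ʳ α + fromℕ 4 * x ^ʳ α) * G
                                  ≈⟨ solve 2 (λ x G → (:4 :* x :+ :4 :* x) :* G := (G :* :8) :* x)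
                                       refl (x ^ʳ α) G ⟩
    (G * fromℕ 8) * x ^ʳ α        ≈⟨ *-congʳ G*8≈m′ ⟩
    m′ * x ^ʳ α                   ≤⟨ passes ⟩
    g i s                         ≤⟨ f-mono-≤ i (ℕ.+-monoʳ-≤ (n i) (ℕ.n≤1+n s)) ⟩
    g i (suc s)                   ∎
    where
    x = fromℕ s / τ′
    y≤4x^α : k^-a ≤ fromℕ 4 * x ^ʳ α
    y≤4x^α = k^-a≤C*x^α (≤-trans (≤-reflexive (sym (+-identityʳ 1#))) (fromℕ-mono-≤ {1} {4} (s≤s z≤n))) (begin
      1#                                    ≤⟨ z*y≤x⇒z≤x/y 0<τ′ (begin
        1# * τ′                                ≈⟨ trans (*-identityˡ τ′) (sym τ≈τ′) ⟩
        fromℕ τ                                ≤⟨ fromℕ-mono-≤ τ≤2q₀s ⟩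
        fromℕ (q₀ ℕ.* (2 ℕ.* s))               ≈⟨ trans (fromℕ-* q₀ _) (*-congˡ (fromℕ-* 2 s)) ⟩
        fromℕ q₀ * (fromℕ 2 * fromℕ s)         ≤⟨ *-monoˡ-≤ (*-nonNeg (fromℕ-nonNeg 2) (fromℕ-nonNeg s)) q₀≤2ky ⟩
        (ky + ky) * (fromℕ 2 * fromℕ s)        ≈⟨ solve 2 (λ y s → (y :+ y) :* (:2 :* s) := s :* (:4 :* y))
                                                    refl ky (fromℕ s) ⟩
        fromℕ s * (fromℕ 4 * ky)               ∎) ⟩
      (fromℕ s * (fromℕ 4 * ky)) / τ′       ≈⟨ solve 3 (λ s y t → (s :* y) :* t := (s :* t) :* y)
                                                 refl (fromℕ s) (fromℕ 4 * ky) (τ′ ⁻¹) ⟩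
      x * (fromℕ 4 * ky)                    ∎)

  𝔼-stage2 : k^-a * G ≤ 𝔼 (stage2 n) (λ i → f i T)
  𝔼-stage2 = *-cancelˡ-≤ 0<k (begin
    fromℕ k * (k^-a * G)   ≈⟨ *-assoc _ _ _ ⟨
    ky * G                 ≤⟨ *-monoˡ-≤ 0≤G ky≤q₀ ⟩
    fromℕ q₀ * G           ≤⟨ q*G≤r*𝔼-run (λ i → f i T) N g≤fT i⋆ τ q₀ G M M≤G
                                (λ i → f-nonNeg i T) passes-0 best-reaches-G long-played-reaches-M
                                q₀ (Vec.allFin k) N (const ⊥±)
                                (λ {i} {j} eq → ≡.trans (≡.sym (Vec.lookup-allFin i))
                                                        (≡.trans eq (Vec.lookup-allFin j)))
                                i⋆ (Vec.lookup-allFin i⋆) ℕ.≤-refl (λ _ → AddExtrema.⊥±≤_ _ _)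
                                initially ⟩
    fromℕ k * 𝔼 (stage2 n) (λ i → f i T) ∎)
    where
    initially = record
      { draws   = ≡.refl
      ; arms    = ≡.refl
      ; budget  = ≡.trans (ℕ.+-identityʳ N) (≡.sym (ℕ.m∸n+n≡m k≤N))
      ; waste-≤ = ℕ.≤-reflexive (ℕ.*-zeroʳ q₀)
      ; q≤r     = q₀≤k
      ; q*G≤r*M = ≤-reflexive (trans (sym (/-*-cancel 0<k)) (*-comm _ _))
      }

  -- The condition on the remaining horizon gives m′ ≥ δ f⋆(T), which replaces the
  -- instance-dependent `G` by a fixed fraction of f⋆(T).
  stage2-bound : ∀ {δ} → δ * fromℕ T ≤ τ′ →
                 ((δ / fromℕ 8) * k^-a) * f i⋆ T ≤ 𝔼 (stage2 n) (λ i → f i T)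
  stage2-bound {δ} δT≤τ′ = begin
    ((δ / fromℕ 8) * k^-a) * f i⋆ T
      ≈⟨ solve 4 (λ d e y x → ((d :* e) :* y) :* x := y :* ((d :* x) :* e))
           refl δ (fromℕ 8 ⁻¹) k^-a (f i⋆ T) ⟩
    k^-a * ((δ * f i⋆ T) / fromℕ 8)
      ≤⟨ *-monoʳ-≤ (<⇒≤ 0<k^-a) (*-monoˡ-≤ (<⇒≤ (⁻¹-positive 0<8))
           (*-monoˡ-≤ (f-nonNeg i⋆ T) (z*y≤x⇒z≤x/y 0<T δT≤τ′))) ⟩
    k^-a * G
      ≤⟨ 𝔼-stage2 ⟩
    𝔼 (stage2 n) (λ i → f i T) ∎

theorem4p4p1 : (R : Reals) → let open Bandits R in
    (δ : ℝ) → 0# < δ →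
    ∃ λ (c : ℝ) → 0# < c ×
    ((k T : ℕ) → 1 ℕ.≤ T →
    (I : Instance k) (i⋆ : Fin k) → IsBest I T i⋆ →
    0# < envelopeExponent I T → envelopeExponent I T ≤ 1# →
    (α : ℝ) → envelopeExponent I T < α → α ≤ 1# →
    (B : ℕ) → 1 ℕ.≤ B → B ℕ.≤ T →
    (ties : ℕ → ArgMax k) →
    let open Hybrid I T i⋆ ties α B in
    ((θ : ℕ) → [ 0# ] <± gap I T i⋆ →
    2 ℕ.* θ ℕ.≤ T → GapClearance I T i⋆ θ →
    θ ℕ.< B → 2 ℕ.* B ℕ.≤ T →
    stage1 ≡ inj₁ i⋆)
    ×
    ((n : Fin k → ℕ) → stage1 ≡ inj₂ n → δ * fromℕ T ≤ τ′ →
    (c * fromℕ k ^ʳ (- (α / (1# + α)))) * Instance.reward I i⋆ T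
    ≤ 𝔼 hybrid (λ î → Instance.reward I î T)))
theorem4p4p1 R δ 0<δ =
  δ / fromℕ 8 , *-positive 0<δ (⁻¹-positive (fromℕ-positive {8} (s≤s z≤n))) ,
  λ k T 1≤T I i⋆ best 0<β _ α β<α α≤1 B 1≤B B≤T ties →
    let open Hybrid I T i⋆ ties α B
        open Stage1 R I T i⋆ best ties α B
        0<α = <-≤-trans 0<β (<⇒≤ β<α)
        value : Random (Fin k) → ℝ
        value p = 𝔼 p (λ î → Instance.reward I î T)
    in
    (λ θ _ _ clearance θ<B _ → stage1-commits θ clearance θ<B) ,
    λ n stage1≡n δT≤τ′ →
      ≡.subst (λ r → _ ≤ value ([ return , stage2 ]′ r)) (≡.sym stage1≡n)
        (Stage2.stage2-bound R I T 1≤T i⋆ ties α B B≤T 0<α α≤1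
          (Envelope.LE-above-exponent R I T 1≤T β<α α≤1 i⋆)
          -- Positivity of δ and T makes τ′ positive, so the quotients s/τ′ in the tests are
          -- genuine.
          (<-≤-trans (*-positive 0<δ (fromℕ-positive 1≤T)) δT≤τ′)
          n (stage1-counts-≤ n stage1≡n) δT≤τ′)
  where
  open Bandits R
  open OrderedField R
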